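{- Let $\alpha,\beta>0$ and $0<\delta<\beta$ be fixed constants, and let $n$ be sufficiently large. Let $a,b\in\mathbb{N}$ with $\ln^2 n\le a\le b\le n$, and $h,p\in\mathbb{R}$ with $1\le h\le n^{\delta}$ and $p\in(0,1]$, all be functions of $n$ which satisfy $aph\le\alpha\cdot\ln n$ and $bp>n^{\beta}$. Then there exists a constant $C=C(\alpha,\delta)\ge 1$, depending only on $\alpha$ and $\delta$, such that in $G(A,B,p)$, where $|A|=a$ and $|B|=b$, $$\mathbb{P}\left(\exists A'\subseteq A \text{ with } |A'|\le\frac{1}{ph} \text{ and a dominating set } D\subset B \text{ of } A\setminus A' \text{ with } |D|\le C\cdot\frac{\ln(eh)}{ph}\right)\ \ge\ 1-\exp\left[-\frac{n^{ -\delta}\cdot b}{C}\right].$$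
   Context: For disjoint sets $A,B$ and $p\in[0,1]$, $G(A,B,p)$ is the random bipartite graph with parts $A$ and $B$ in which each edge with one endpoint in $A$ and the other in $B$ is included independently with probability $p$. For $S\subseteq A$, a set $D\subseteq B$ is a dominating set of $S$ if every vertex of $S$ has at least one neighbour in $D$. Here $e$ is the base of the natural logarithm. -}

module Defs where

open import Algebra.Bundles using (CommutativeRing; Semiring)
open import Axiom.ExcludedMiddle using (ExcludedMiddle)
open import Data.Bool.Base using (true; false; if_then_else_)
open import Data.Fin.Base using (Fin)
open import Data.Fin.Subset using (Subset; _∈_)
open import Data.List.Base using (List; []; _∷_; cartesianProductWith; foldr; map)
open import Data.Nat.Base as ℕ using (ℕ; zero; suc)
open import Data.Product.Base using (∃; _×_; _,_)
open import Data.Vec.Base using (Vec; []; _∷_; lookup)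
open import Level using (0ℓ)
open import Relation.Binary.Core using (Rel)
open import Relation.Binary.Structures using (IsTotalOrder)
open import Relation.Nullary using (¬_; does; yes; no)
import Algebra.Definitions.RawSemiring as RawSemiringDefinitions
import Relation.Binary.Construct.NonStrictToStrict as NonStrictToStrict

-- The real numbers, axiomatised as a complete ordered field. Under excluded
-- middle such a structure is unique up to isomorphism. The value of 0# ⁻¹ is
-- left unspecified.

record CompleteOrderedField : Set₁ where
  infix  4 _≤_
  infix  8 _⁻¹
  field
    commutativeRing : CommutativeRing 0ℓ 0ℓ

  open CommutativeRing commutativeRing public

  field
    _≤_          : Rel Carrier 0ℓ
    _⁻¹          : Carrier → Carrier
    isTotalOrder : IsTotalOrder _≈_ _≤_
    0≉1          : ¬ (0# ≈ 1#)
    ⁻¹-inverseʳ  : ∀ x → ¬ (x ≈ 0#) → x * x ⁻¹ ≈ 1#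
    +-monoˡ-≤    : ∀ z {x y} → x ≤ y → x + z ≤ y + z
    *-nonneg     : ∀ {x y} → 0# ≤ x → 0# ≤ y → 0# ≤ x * y

  UpperBound : (Carrier → Set) → Carrier → Set
  UpperBound P u = ∀ x → P x → x ≤ u

  field
    supremum : (P : Carrier → Set) → ∃ P → ∃ (UpperBound P) →
               ∃ λ s → UpperBound P s × (∀ u → UpperBound P u → s ≤ u)

  open NonStrictToStrict _≈_ _≤_ public using (_<_)

-- A bipartite graph with parts A = Fin a and B = Fin b, given by the list of
-- the neighbourhoods (subsets of A) of the vertices of B.

BipartiteGraph : ℕ → ℕ → Set
BipartiteGraph a b = Vec (Subset a) b

Adjacent : ∀ {a b} → BipartiteGraph a b → Fin a → Fin b → Set
Adjacent G u v = u ∈ lookup G v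

Dominates : ∀ {a b} → BipartiteGraph a b → Subset b → Subset a → Set
Dominates G D S = ∀ u → u ∈ S → ∃ λ v → v ∈ D × Adjacent G u v

allVecs : ∀ {X : Set} → List X → ∀ n → List (Vec X n)
allVecs xs zero    = [] ∷ []
allVecs xs (suc n) = cartesianProductWith _∷_ xs (allVecs xs n)

allBipartiteGraphs : ∀ a b → List (BipartiteGraph a b)
allBipartiteGraphs a b = allVecs (allVecs (true ∷ false ∷ []) a) b

module Reals (em : ExcludedMiddle 0ℓ) (R : CompleteOrderedField) where

  open CompleteOrderedField R public
    using (_≈_; _≤_; _<_; _+_; _*_; _-_; -_; 0#; 1#; _⁻¹)
    renaming (Carrier to ℝ)
  open RawSemiringDefinitions
    (Semiring.rawSemiring (CompleteOrderedField.semiring R)) public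
    using (_^_; product)
    renaming (_×_ to _·_)

  infixl 7 _/_
  _/_ : ℝ → ℝ → ℝ
  x / y = x * y ⁻¹

  fromℕ : ℕ → ℝ
  fromℕ n = n · 1#

  _⟶_ : (ℕ → ℝ) → ℝ → Set
  s ⟶ l = ∀ ε → 0# < ε →
    ∃ λ N → ∀ m → N ℕ.≤ m → (l - ε < s m) × (s m < l + ε)

  -- An element satisfying P, and 0# when there is none. It is used below only
  -- where such an element exists and is unique up to ≈ (for ln, on positive
  -- arguments).

  the : (ℝ → Set) → ℝ
  the P with em {∃ P}
  ... | yes (x , _) = x
  ... | no  _       = 0#

  factorial : ℕ → ℝ
  factorial zero    = 1#
  factorial (suc k) = fromℕ (suc k) * factorial k

  expPartialSum : ℝ → ℕ → ℝ
  expPartialSum x zero    = 0#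
  expPartialSum x (suc k) = expPartialSum x k + (x ^ k) / factorial k

  exp : ℝ → ℝ
  exp x = the (expPartialSum x ⟶_)

  e : ℝ
  e = exp 1#

  ln : ℝ → ℝ
  ln y = the (λ x → exp x ≈ y)

  -- Real powers of a positive base.

  infixr 8 _^ʳ_
  _^ʳ_ : ℝ → ℝ → ℝ
  x ^ʳ y = exp (y * ln x)

  -- The probability of G under G(A,B,p): each edge contributes a factor p and
  -- each non-edge a factor 1 - p.

  weight : ∀ {a b} → ℝ → BipartiteGraph a b → ℝ
  weight p G = product λ v → product λ u →
    if lookup (lookup G v) u then p else 1# - p

  ℙ : ∀ a b → ℝ → (BipartiteGraph a b → Set) → ℝ
  ℙ a b p E = foldr _+_ 0#
    (map (λ G → if does (em {E G}) then weight p G else 0#)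
         (allBipartiteGraphs a b))

{-# OPTIONS --safe #-}

-- Scan the vertices of B one at a time, keeping the set S of vertices of A not
-- yet dominated, and put a vertex into D when it has many neighbours in S.
-- Write ρ = p h and Λ = ln (e h) ≤ h, let J be the integer part of C Λ / ρ, and
-- choose σ with σ J² = a. Call S of level j when |S| ≤ 1/ρ + σ j²; then A has
-- level J, and k = 1 + ⌊2 σ j⌋ neighbours in a set of level j lower it to level
-- j - 1, so that J successes suffice.
--
-- Each vertex succeeds with probability at least q = n^(-δ) / 2. Cut S into k
-- groups of size g. A group is hit with probability at least 1 / (1 + y) when
-- p g y ≥ 1, so q ≤ (1 + y)^(-k) is enough. If k = 1, take g = |S| and y = h. If
-- k ≥ 2, one can take y = h z with z of order k / (ρ σ j²), and
-- (1 + h z)^k ≤ exp (k (ln h + z)) ≤ n^δ for C large, because a ρ ≤ α ln n and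
-- ln² n ≤ a make σ, σ J ln h / ln n and σ / (ρ ln n) small.
--
-- By induction on b, fewer than J successes occur with probability at most
-- 2^J (1 - q/2)^b ≤ exp (J - q b / 2), and J p ≤ C while b p > n^β, so J is
-- negligible against n^(-δ) b.
module Submission where

-- An average vertex has only p |S| neighbours in S, about 1/h once |S| is near 1/ρ, so D must
-- consist of vertices with unusually many. The hypothesis b p > n^β with β > δ pays for this: about
-- n^(-δ) b vertices realise events of probability n^(-δ), far more than the J ≤ C / p successes
-- that are spent. Each group hit costs a factor of about h, so the budget n^δ buys of order ln n /
-- ln h neighbours per success; as a is at most of order ln n / ρ, of order ln (e h) / ρ successes
-- suffice, which is the size claimed for D. The scan stops at |S| ≤ 1/ρ because there even one
-- neighbour has probability of order 1/h, possibly as small as n^(-δ).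
--
-- The levels are quadratic to balance the exponent k (ln h + z). The part k ln h is worst at the
-- top level, and k z is of order k² / (ρ σ j²), which is the same at every level when k grows
-- linearly in j.
--
-- The bound for one vertex holds for whichever S the history has left, so conditioning on one
-- neighbourhood at a time is enough. The failure bound 2^J (1 - q/2)^b is the one that Markov's
-- inequality gives for 2^(-N), with N the number of successes.

open import Algebra.Bundles using (CommutativeRing; Semiring)
import Algebra.Definitions.RawSemiring
import Algebra.Properties.AbelianGroup
import Algebra.Properties.CommutativeSemiring.Exp
import Algebra.Properties.Ring
import Algebra.Properties.Semiring.Exp
import Algebra.Properties.Semiring.Mult
import Algebra.Properties.Semiring.Mult.TCOptimised
import Algebra.Solver.Ring
open import Algebra.Solver.Ring.AlmostCommutativeRing
  using (fromCommutativeRing; _-Raw-AlmostCommutative⟶_)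
open import Axiom.ExcludedMiddle using (ExcludedMiddle)
open import Data.Bool.Base using (Bool; true; false; if_then_else_)
open import Data.Fin.Base using (zero; suc)
open import Data.Fin.Subset
  using (Subset; ∣_∣; ∁; _∩_; _∈_; _∉_; inside; outside; ⊤; ⊥)
open import Data.Fin.Subset.Properties
  using (∣⊥∣≡0; ∣⊤∣≡n; ∣p∩q∣≤∣p∣; x∈p∩q⁺; x∈∁p⇒x∉p; x∉p⇒x∈∁p; ∈⊤; _∈?_)
open import Data.Integer.Base as ℤ using (ℤ)
import Data.Integer.Properties as ℤ
open import Data.List.Base using (List; []; _∷_; _++_; map; foldr; cartesianProductWith)
import Data.Maybe.Base as Maybe
open import Data.Nat.Base as ℕ using (ℕ; zero; suc)
import Data.Nat.DivMod as ℕ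
import Data.Nat.Properties as ℕ
open import Data.Product.Base using (∃; ∃₂; _×_; _,_; proj₁; proj₂)
open import Data.Sum.Base using (inj₁; inj₂)
open import Data.Vec.Base using (Vec; []; _∷_; lookup; here; there)
open import Function.Base using (_∘_)
open import Level using (0ℓ)
open import Relation.Binary.Bundles using (TotalOrder)
import Relation.Binary.Properties.TotalOrder
open import Relation.Binary.PropositionalEquality as ≡ using (_≡_)
import Relation.Binary.Reasoning.PartialOrder
import Relation.Binary.Reasoning.Setoid
open import Relation.Binary.Structures using (IsTotalOrder)
open import Relation.Nullary using (¬_; yes; no; contradiction; does)
open import Relation.Nullary.Decidable using (dec⇒maybe)
open import Defs

-- The ring solver compares coefficients by computation, which is possible for
-- integers but not for reals.

module IntegerCoefficients (K : CommutativeRing 0ℓ 0ℓ) where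
  open CommutativeRing K
  open Algebra.Properties.Ring ring
    using (-‿distribˡ-*; -‿distribʳ-*; -0#≈0#; -‿involutive)
  open Algebra.Properties.AbelianGroup +-abelianGroup using (⁻¹-∙-comm)
  open Algebra.Properties.Semiring.Mult.TCOptimised semiring
    using (×-homo-+; ×1-homo-*; 1+×) renaming (_×_ to _×′_)
  open Relation.Binary.Reasoning.Setoid setoid

  ⟦_⟧ℤ : ℤ → Carrier
  ⟦ ℤ.+ n ⟧ℤ      = n ×′ 1#
  ⟦ ℤ.-[1+ n ] ⟧ℤ = - (suc n ×′ 1#)

  ⟦⟧ℤ-neg : ∀ i → ⟦ ℤ.- i ⟧ℤ ≈ - ⟦ i ⟧ℤ
  ⟦⟧ℤ-neg (ℤ.+ zero)   = sym -0#≈0#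
  ⟦⟧ℤ-neg (ℤ.+ suc n)  = refl
  ⟦⟧ℤ-neg ℤ.-[1+ n ]   = sym (-‿involutive _)

  [1+x]-[1+y] : ∀ x y → (1# + x) - (1# + y) ≈ x - y
  [1+x]-[1+y] x y = begin
    (1# + x) - (1# + y)        ≈⟨ +-cong (+-comm 1# x) (sym (⁻¹-∙-comm 1# y)) ⟩
    (x + 1#) + (- 1# + - y)    ≈⟨ +-assoc x 1# _ ⟩
    x + (1# + (- 1# + - y))    ≈⟨ +-congˡ (+-assoc 1# (- 1#) (- y)) ⟨
    x + ((1# - 1#) + - y)      ≈⟨ +-congˡ (+-congʳ (-‿inverseʳ 1#)) ⟩
    x + (0# + - y)             ≈⟨ +-congˡ (+-identityˡ (- y)) ⟩
    x - y                      ∎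

  ⟦⟧ℤ-⊖ : ∀ m n → ⟦ m ℤ.⊖ n ⟧ℤ ≈ m ×′ 1# - n ×′ 1#
  ⟦⟧ℤ-⊖ zero    zero    = sym (-‿inverseʳ 0#)
  ⟦⟧ℤ-⊖ zero    (suc n) = sym (+-identityˡ _)
  ⟦⟧ℤ-⊖ (suc m) zero    = sym (trans (+-congˡ -0#≈0#) (+-identityʳ _))
  ⟦⟧ℤ-⊖ (suc m) (suc n) = begin
    ⟦ suc m ℤ.⊖ suc n ⟧ℤ                ≡⟨ ≡.cong ⟦_⟧ℤ (ℤ.[1+m]⊖[1+n]≡m⊖n m n) ⟩
    ⟦ m ℤ.⊖ n ⟧ℤ                        ≈⟨ ⟦⟧ℤ-⊖ m n ⟩
    m ×′ 1# - n ×′ 1#                   ≈⟨ [1+x]-[1+y] _ _ ⟨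
    (1# + m ×′ 1#) - (1# + n ×′ 1#)     ≈⟨ +-cong (1+× m 1#) (-‿cong (1+× n 1#)) ⟨
    suc m ×′ 1# - suc n ×′ 1#           ∎

  ⟦⟧ℤ-+ : ∀ i j → ⟦ i ℤ.+ j ⟧ℤ ≈ ⟦ i ⟧ℤ + ⟦ j ⟧ℤ
  ⟦⟧ℤ-+ (ℤ.+ m)    (ℤ.+ n)    = ×-homo-+ 1# m n
  ⟦⟧ℤ-+ (ℤ.+ m)    ℤ.-[1+ n ] = ⟦⟧ℤ-⊖ m (suc n)
  ⟦⟧ℤ-+ ℤ.-[1+ m ] (ℤ.+ n)    = trans (⟦⟧ℤ-⊖ n (suc m)) (+-comm _ _)
  ⟦⟧ℤ-+ ℤ.-[1+ m ] ℤ.-[1+ n ] = begin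
    - (suc (suc (m ℕ.+ n)) ×′ 1#)       ≡⟨ ≡.cong (λ k → - (suc k ×′ 1#)) (ℕ.+-suc m n) ⟨
    - ((suc m ℕ.+ suc n) ×′ 1#)         ≈⟨ -‿cong (×-homo-+ 1# (suc m) (suc n)) ⟩
    - (suc m ×′ 1# + suc n ×′ 1#)       ≈⟨ ⁻¹-∙-comm _ _ ⟨
    - (suc m ×′ 1#) - suc n ×′ 1#       ∎

  ⟦⟧ℤ-*⁺ : ∀ m j → ⟦ ℤ.+ m ℤ.* j ⟧ℤ ≈ m ×′ 1# * ⟦ j ⟧ℤ
  ⟦⟧ℤ-*⁺ m (ℤ.+ n)    = begin
    ⟦ ℤ.+ m ℤ.* ℤ.+ n ⟧ℤ  ≡⟨ ≡.cong ⟦_⟧ℤ (ℤ.pos-* m n) ⟨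
    (m ℕ.* n) ×′ 1#       ≈⟨ ×1-homo-* m n ⟩
    m ×′ 1# * n ×′ 1#     ∎
  ⟦⟧ℤ-*⁺ m ℤ.-[1+ n ] = begin
    ⟦ ℤ.+ m ℤ.* ℤ.- ℤ.+ suc n ⟧ℤ    ≡⟨ ≡.cong ⟦_⟧ℤ (ℤ.neg-distribʳ-* (ℤ.+ m) (ℤ.+ suc n)) ⟨
    ⟦ ℤ.- (ℤ.+ m ℤ.* ℤ.+ suc n) ⟧ℤ  ≈⟨ ⟦⟧ℤ-neg (ℤ.+ m ℤ.* ℤ.+ suc n) ⟩
    - ⟦ ℤ.+ m ℤ.* ℤ.+ suc n ⟧ℤ      ≈⟨ -‿cong (⟦⟧ℤ-*⁺ m (ℤ.+ suc n)) ⟩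
    - (m ×′ 1# * suc n ×′ 1#)       ≈⟨ -‿distribʳ-* _ _ ⟩
    m ×′ 1# * - (suc n ×′ 1#)       ∎

  ⟦⟧ℤ-* : ∀ i j → ⟦ i ℤ.* j ⟧ℤ ≈ ⟦ i ⟧ℤ * ⟦ j ⟧ℤ
  ⟦⟧ℤ-* (ℤ.+ m)    j = ⟦⟧ℤ-*⁺ m j
  ⟦⟧ℤ-* ℤ.-[1+ m ] j = begin
    ⟦ ℤ.- ℤ.+ suc m ℤ.* j ⟧ℤ    ≡⟨ ≡.cong ⟦_⟧ℤ (ℤ.neg-distribˡ-* (ℤ.+ suc m) j) ⟨
    ⟦ ℤ.- (ℤ.+ suc m ℤ.* j) ⟧ℤ  ≈⟨ ⟦⟧ℤ-neg (ℤ.+ suc m ℤ.* j) ⟩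
    - ⟦ ℤ.+ suc m ℤ.* j ⟧ℤ      ≈⟨ -‿cong (⟦⟧ℤ-*⁺ (suc m) j) ⟩
    - (suc m ×′ 1# * ⟦ j ⟧ℤ)    ≈⟨ -‿distribˡ-* _ _ ⟩
    - (suc m ×′ 1#) * ⟦ j ⟧ℤ    ∎

  morphism : ℤ.+-*-rawRing -Raw-AlmostCommutative⟶ fromCommutativeRing K
  morphism = record
    { ⟦_⟧    = ⟦_⟧ℤ
    ; +-homo = ⟦⟧ℤ-+
    ; *-homo = ⟦⟧ℤ-*
    ; -‿homo = ⟦⟧ℤ-neg
    ; 0-homo = refl
    ; 1-homo = refl
    }

  open Algebra.Solver.Ring ℤ.+-*-rawRing (fromCommutativeRing K) morphism
    (λ i j → Maybe.map (λ eq → reflexive (≡.cong ⟦_⟧ℤ eq)) (dec⇒maybe (i ℤ.≟ j)))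
    public using (Polynomial; solve; _:=_; _:+_; _:*_; _:-_; :-_; con)

  -- Numerals in the solver's own interpretation: `lit k` and the coefficient `:lit k` then agree by
  -- computation, which `fromℕ k` would not guarantee.
  lit : ℕ → Carrier
  lit n = ⟦ ℤ.+ n ⟧ℤ

  :lit : ∀ {n} → ℕ → Polynomial n
  :lit k = con (ℤ.+ k)

  :0 :1 : ∀ {n} → Polynomial n
  :0 = con (ℤ.+ 0)
  :1 = con (ℤ.+ 1)

-- Arithmetic of inequalities in an ordered field.

module OrderedField (R : CompleteOrderedField) where

  open CompleteOrderedField R public
    hiding (zero)
    renaming (Carrier to ℝ)
  open IsTotalOrder isTotalOrder public
    using (total; antisym)
    renaming (refl to ≤-refl; reflexive to ≤-reflexive; trans to ≤-trans;
              ≤-respˡ-≈ to ≤-respˡ; ≤-respʳ-≈ to ≤-respʳ)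
  open IntegerCoefficients commutativeRing public
    using (solve; _:=_; _:+_; _:*_; _:-_; :-_; :0; :1; lit; :lit)
  open Algebra.Definitions.RawSemiring (Semiring.rawSemiring semiring) public
    using (_^_; product)
    renaming (_×_ to _·_)

  totalOrder : TotalOrder 0ℓ 0ℓ 0ℓ
  totalOrder = record { isTotalOrder = isTotalOrder }

  open Relation.Binary.Properties.TotalOrder totalOrder public
    using (≰⇒>; <⇒≱; <⇒≉)

  module ≤-Reasoning =
    Relation.Binary.Reasoning.PartialOrder (TotalOrder.poset totalOrder)
  module ≈-Reasoning = Relation.Binary.Reasoning.Setoid setoid

  <⇒≤ : ∀ {x y} → x < y → x ≤ y
  <⇒≤ = proj₁

  <-≤-trans : ∀ {x y z} → x < y → y ≤ z → x < z
  <-≤-trans (x≤y , x≉y) y≤z =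
    ≤-trans x≤y y≤z , λ x≈z → x≉y (antisym x≤y (≤-trans y≤z (≤-reflexive (sym x≈z))))

  ≤-<-trans : ∀ {x y z} → x ≤ y → y < z → x < z
  ≤-<-trans x≤y (y≤z , y≉z) =
    ≤-trans x≤y y≤z , λ x≈z → y≉z (antisym y≤z (≤-trans (≤-reflexive (sym x≈z)) x≤y))

  +-monoʳ-≤ : ∀ z {x y} → x ≤ y → z + x ≤ z + y
  +-monoʳ-≤ z {x} {y} x≤y =
    ≤-respˡ (+-comm x z) (≤-respʳ (+-comm y z) (+-monoˡ-≤ z x≤y))

  +-mono-≤ : ∀ {w x y z} → w ≤ x → y ≤ z → w + y ≤ x + z
  +-mono-≤ {x = x} {y = y} w≤x y≤z = ≤-trans (+-monoˡ-≤ y w≤x) (+-monoʳ-≤ x y≤z)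

  -- The second hypothesis says that y - x ≈ b - a.
  shift-≤ : ∀ {a b x y} → a ≤ b → y + a ≈ x + b → x ≤ y
  shift-≤ {a} {b} {x} {y} a≤b eq = begin
    x                ≈⟨ solve 2 (λ x b → x := (x :+ b) :- b) refl x b ⟩
    (x + b) - b      ≈⟨ +-congʳ eq ⟨
    (y + a) - b      ≤⟨ +-monoˡ-≤ (- b) (+-monoʳ-≤ y a≤b) ⟩
    (y + b) - b      ≈⟨ solve 2 (λ y b → y := (y :+ b) :- b) refl y b ⟨
    y                ∎
    where open ≤-Reasoning

  +-cancelʳ-≤ : ∀ z {x y} → x + z ≤ y + z → x ≤ y
  +-cancelʳ-≤ z {x} {y} le = shift-≤ le
    (solve 3 (λ x y z → y :+ (x :+ z) := x :+ (y :+ z)) refl x y z)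

  x≤y⇒0≤y-x : ∀ {x y} → x ≤ y → 0# ≤ y - x
  x≤y⇒0≤y-x {x} {y} le = shift-≤ le
    (solve 2 (λ x y → (y :- x) :+ x := :0 :+ y) refl x y)

  0≤y-x⇒x≤y : ∀ {x y} → 0# ≤ y - x → x ≤ y
  0≤y-x⇒x≤y {x} {y} le = shift-≤ le
    (solve 2 (λ x y → y :+ :0 := x :+ (y :- x)) refl x y)

  neg-anti-≤ : ∀ {x y} → x ≤ y → - y ≤ - x
  neg-anti-≤ {x} {y} le = shift-≤ le
    (solve 2 (λ x y → :- x :+ x := :- y :+ y) refl x y)

  0≤-x : ∀ {x} → x ≤ 0# → 0# ≤ - x
  0≤-x {x} le = shift-≤ le
    (solve 1 (λ x → :- x :+ x := :0 :+ :0) refl x)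

  +-nonneg : ∀ {x y} → 0# ≤ x → 0# ≤ y → 0# ≤ x + y
  +-nonneg 0≤x 0≤y = ≤-respˡ (+-identityˡ 0#) (+-mono-≤ 0≤x 0≤y)

  x≤x+y : ∀ {x y} → 0# ≤ y → x ≤ x + y
  x≤x+y {x} {y} 0≤y = shift-≤ 0≤y (trans (+-assoc x y 0#) (+-congˡ (+-identityʳ y)))

  x≤y+x : ∀ {x y} → 0# ≤ y → x ≤ y + x
  x≤y+x {x} {y} 0≤y = ≤-respʳ (+-comm x y) (x≤x+y 0≤y)

  x+x≥0⇒x≥0 : ∀ {x} → 0# ≤ x + x → 0# ≤ x
  x+x≥0⇒x≥0 {x} le with total 0# x
  ... | inj₁ 0≤x = 0≤x
  ... | inj₂ x≤0 = shift-≤ (+-mono-≤ le x≤0)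
    (solve 1 (λ x → x :+ (:0 :+ x) := :0 :+ (x :+ x :+ :0)) refl x)

  square-nonneg : ∀ x → 0# ≤ x * x
  square-nonneg x with total 0# x
  ... | inj₁ 0≤x = *-nonneg 0≤x 0≤x
  ... | inj₂ x≤0 = ≤-respʳ (solve 1 (λ x → :- x :* :- x := x :* x) refl x)
                     (*-nonneg (0≤-x x≤0) (0≤-x x≤0))

  0≤1 : 0# ≤ 1#
  0≤1 = ≤-respʳ (*-identityˡ 1#) (square-nonneg 1#)

  0<1 : 0# < 1#
  0<1 = 0≤1 , 0≉1

  *-monoʳ-≤ : ∀ {z x y} → 0# ≤ z → x ≤ y → z * x ≤ z * y
  *-monoʳ-≤ {z} {x} {y} 0≤z x≤y = shift-≤ (*-nonneg 0≤z (x≤y⇒0≤y-x x≤y))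
    (solve 3 (λ x y z → z :* y :+ :0 := z :* x :+ z :* (y :- x)) refl x y z)

  *-monoˡ-≤ : ∀ {z x y} → 0# ≤ z → x ≤ y → x * z ≤ y * z
  *-monoˡ-≤ {z} {x} {y} 0≤z x≤y =
    ≤-respˡ (*-comm z x) (≤-respʳ (*-comm z y) (*-monoʳ-≤ 0≤z x≤y))

  *-mono-≤ : ∀ {w x y z} → 0# ≤ w → 0# ≤ y → w ≤ x → y ≤ z → w * y ≤ x * z
  *-mono-≤ 0≤w 0≤y w≤x y≤z =
    ≤-trans (*-monoˡ-≤ 0≤y w≤x) (*-monoʳ-≤ (≤-trans 0≤w w≤x) y≤z)

  pos⇒≉0 : ∀ {x} → 0# < x → ¬ (x ≈ 0#)
  pos⇒≉0 0<x x≈0 = <⇒≉ 0<x (sym x≈0)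

  ⁻¹-inverseˡ : ∀ {x} → 0# < x → x ⁻¹ * x ≈ 1#
  ⁻¹-inverseˡ {x} 0<x = trans (*-comm _ x) (⁻¹-inverseʳ x (pos⇒≉0 0<x))

  ⁻¹-nonneg : ∀ {x} → 0# < x → 0# ≤ x ⁻¹
  ⁻¹-nonneg {x} 0<x with total 0# (x ⁻¹)
  ... | inj₁ le = le
  ... | inj₂ le = contradiction (antisym 0≤1 (begin
    1#          ≈⟨ ⁻¹-inverseʳ x (pos⇒≉0 0<x) ⟨
    x * x ⁻¹    ≤⟨ *-monoʳ-≤ (<⇒≤ 0<x) le ⟩
    x * 0#      ≈⟨ zeroʳ x ⟩
    0#          ∎)) 0≉1
    where open ≤-Reasoning

  *-cancelʳ-≤ : ∀ {z x y} → 0# < z → x * z ≤ y * z → x ≤ y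
  *-cancelʳ-≤ {z} {x} {y} 0<z le = begin
    x                ≈⟨ cancel x ⟨
    x * z * z ⁻¹     ≤⟨ *-monoˡ-≤ (⁻¹-nonneg 0<z) le ⟩
    y * z * z ⁻¹     ≈⟨ cancel y ⟩
    y                ∎
    where
    open ≤-Reasoning
    cancel : ∀ w → w * z * z ⁻¹ ≈ w
    cancel w = trans (*-assoc w z _)
      (trans (*-congˡ (⁻¹-inverseʳ z (pos⇒≉0 0<z))) (*-identityʳ w))

  *-cancelˡ-≤ : ∀ {z x y} → 0# < z → z * x ≤ z * y → x ≤ y
  *-cancelˡ-≤ {z} {x} {y} 0<z le =
    *-cancelʳ-≤ 0<z (≤-respˡ (*-comm z x) (≤-respʳ (*-comm z y) le))

  *-cancelʳ-≈ : ∀ {z x y} → 0# < z → x * z ≈ y * z → x ≈ y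
  *-cancelʳ-≈ 0<z eq = antisym (*-cancelʳ-≤ 0<z (≤-reflexive eq))
                               (*-cancelʳ-≤ 0<z (≤-reflexive (sym eq)))

  *-pos : ∀ {x y} → 0# < x → 0# < y → 0# < x * y
  *-pos {x} {y} 0<x 0<y = *-nonneg (<⇒≤ 0<x) (<⇒≤ 0<y) , λ 0≈xy →
    <⇒≉ 0<x (*-cancelʳ-≈ 0<y (trans (zeroˡ y) 0≈xy))

  ⁻¹-pos : ∀ {x} → 0# < x → 0# < x ⁻¹
  ⁻¹-pos {x} 0<x = ⁻¹-nonneg 0<x , λ 0≈x⁻¹ → 0≉1 (begin
    0#          ≈⟨ zeroʳ x ⟨
    x * 0#      ≈⟨ *-congˡ 0≈x⁻¹ ⟩
    x * x ⁻¹    ≈⟨ ⁻¹-inverseʳ x (pos⇒≉0 0<x) ⟩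
    1#          ∎)
    where open ≈-Reasoning

  +-pos : ∀ {x y} → 0# < x → 0# ≤ y → 0# < x + y
  +-pos 0<x 0≤y = <-≤-trans 0<x (x≤x+y 0≤y)

  x*y⁻¹≤z : ∀ {x y z} → 0# < y → x ≤ z * y → x * y ⁻¹ ≤ z
  x*y⁻¹≤z {x} {y} {z} 0<y le = *-cancelʳ-≤ 0<y (begin
    x * y ⁻¹ * y  ≈⟨ trans (*-assoc x _ y) (trans (*-congˡ (⁻¹-inverseˡ 0<y)) (*-identityʳ x)) ⟩
    x             ≤⟨ le ⟩
    z * y         ∎)
    where open ≤-Reasoning

  z≤x*y⁻¹ : ∀ {x y z} → 0# < y → z * y ≤ x → z ≤ x * y ⁻¹
  z≤x*y⁻¹ {x} {y} {z} 0<y le = *-cancelʳ-≤ 0<y (begin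
    z * y         ≤⟨ le ⟩
    x             ≈⟨ trans (*-assoc x _ y) (trans (*-congˡ (⁻¹-inverseˡ 0<y)) (*-identityʳ x)) ⟨
    x * y ⁻¹ * y  ∎)
    where open ≤-Reasoning

  ^-nonneg : ∀ {x} n → 0# ≤ x → 0# ≤ x ^ n
  ^-nonneg zero    0≤x = 0≤1
  ^-nonneg (suc n) 0≤x = *-nonneg 0≤x (^-nonneg n 0≤x)

  ^-mono-≤ : ∀ {x y} n → 0# ≤ x → x ≤ y → x ^ n ≤ y ^ n
  ^-mono-≤ zero    0≤x x≤y = ≤-refl
  ^-mono-≤ (suc n) 0≤x x≤y = *-mono-≤ 0≤x (^-nonneg n 0≤x) x≤y (^-mono-≤ n 0≤x x≤y)

  1≤^ : ∀ {x} n → 1# ≤ x → 1# ≤ x ^ n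
  1≤^ zero    1≤x = ≤-refl
  1≤^ {x} (suc n) 1≤x = ≤-respˡ (*-identityˡ 1#) (*-mono-≤ 0≤1 0≤1 1≤x (1≤^ n 1≤x))

  fromℕ : ℕ → ℝ
  fromℕ n = n · 1#

  fromℕ-nonneg : ∀ n → 0# ≤ fromℕ n
  fromℕ-nonneg zero    = ≤-refl
  fromℕ-nonneg (suc n) = +-nonneg 0≤1 (fromℕ-nonneg n)

  fromℕ-pos : ∀ n → 0# < fromℕ (suc n)
  fromℕ-pos n = +-pos 0<1 (fromℕ-nonneg n)

  fromℕ-mono : ∀ {m n} → m ℕ.≤ n → fromℕ m ≤ fromℕ n
  fromℕ-mono {n = n} ℕ.z≤n = fromℕ-nonneg n
  fromℕ-mono (ℕ.s≤s m≤n)   = +-monoʳ-≤ 1# (fromℕ-mono m≤n)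

  lit-nonneg : ∀ n → 0# ≤ lit n
  lit-nonneg n = ≤-respʳ (Algebra.Properties.Semiring.Mult.TCOptimised.×ᵤ≈× semiring n 1#) (fromℕ-nonneg n)

  1≤fromℕ : ∀ {n} → 1 ℕ.≤ n → 1# ≤ fromℕ n
  1≤fromℕ 1≤n = ≤-respˡ (+-identityʳ 1#) (fromℕ-mono 1≤n)

  fromℕ-+ : ∀ m n → fromℕ (m ℕ.+ n) ≈ fromℕ m + fromℕ n
  fromℕ-+ m n = Algebra.Properties.Semiring.Mult.×-homo-+ semiring 1# m n

  fromℕ-* : ∀ m n → fromℕ (m ℕ.* n) ≈ fromℕ m * fromℕ n
  fromℕ-* = Algebra.Properties.Semiring.Mult.×1-homo-* semiring

-- The Archimedean property and integer parts.

module Archimedean (em : ExcludedMiddle 0ℓ) (R : CompleteOrderedField) where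

  open OrderedField R

  -- If x exceeded every natural number, the naturals would have a supremum s; since n + 1 ≤ s for
  -- every n, also s - 1 would be an upper bound.
  archimedean : ∀ x → ∃ λ n → x ≤ fromℕ n
  archimedean x with em {∃ λ n → x ≤ fromℕ n}
  ... | yes found = found
  ... | no  ¬found = contradiction (s≤u (s - 1#) below) λ s≤s-1 →
      0≉1 (antisym 0≤1 (shift-≤ s≤s-1
        (solve 1 (λ s → :0 :+ s := :1 :+ (s :- :1)) refl s)))
    where
    P : ℝ → Set
    P y = ∃ λ n → y ≈ fromℕ n
    bounded : UpperBound P x
    bounded y (n , y≈n) = ≤-respˡ (sym y≈n) (<⇒≤ (≰⇒> λ x≤n → ¬found (n , x≤n)))
    sup = supremum P (0# , 0 , refl) (x , bounded)
    s = proj₁ sup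
    s≤u = proj₂ (proj₂ sup)
    below : UpperBound P (s - 1#)
    below y (n , y≈n) = shift-≤ (proj₁ (proj₂ sup) (1# + y) (suc n , +-congˡ y≈n))
      (solve 2 (λ s y → (s :- :1) :+ (:1 :+ y) := y :+ s) refl s y)

  floor : ∀ x → 0# ≤ x → ∃ λ n → fromℕ n ≤ x × x ≤ fromℕ (suc n)
  floor x 0≤x = search (proj₁ bound) (proj₂ bound)
    where
    bound = archimedean x
    search : ∀ N → x ≤ fromℕ N → ∃ λ n → fromℕ n ≤ x × x ≤ fromℕ (suc n)
    search zero    x≤0 = 0 , 0≤x , ≤-trans x≤0 (fromℕ-nonneg 1)
    search (suc N) x≤N with total x (fromℕ N)
    ... | inj₁ le = search N le
    ... | inj₂ ge = N , ge , x≤N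

-- The exponential function, from its power series to its inverse.

module Exponential (em : ExcludedMiddle 0ℓ) (R : CompleteOrderedField) where

  open OrderedField R
  open Archimedean em R
  open Reals em R using (_⟶_; the; factorial; exp; ln)
    renaming (expPartialSum to E)

  Σ< : (ℕ → ℝ) → ℕ → ℝ
  Σ< f zero    = 0#
  Σ< f (suc n) = Σ< f n + f n

  Σ<-cong : ∀ {f g} n → (∀ i → i ℕ.< n → f i ≈ g i) → Σ< f n ≈ Σ< g n
  Σ<-cong zero    eq = refl
  Σ<-cong (suc n) eq =
    +-cong (Σ<-cong n λ i i<n → eq i (ℕ.m<n⇒m<1+n i<n)) (eq n ℕ.≤-refl)

  Σ<-mono : ∀ {f g} n → (∀ i → i ℕ.< n → f i ≤ g i) → Σ< f n ≤ Σ< g n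
  Σ<-mono zero    le = ≤-refl
  Σ<-mono (suc n) le =
    +-mono-≤ (Σ<-mono n λ i i<n → le i (ℕ.m<n⇒m<1+n i<n)) (le n ℕ.≤-refl)

  Σ<-+ : ∀ f g n → Σ< (λ i → f i + g i) n ≈ Σ< f n + Σ< g n
  Σ<-+ f g zero    = sym (+-identityˡ 0#)
  Σ<-+ f g (suc n) = trans (+-congʳ (Σ<-+ f g n))
    (solve 4 (λ a b c d → (a :+ b) :+ (c :+ d) := (a :+ c) :+ (b :+ d)) refl
      (Σ< f n) (Σ< g n) (f n) (g n))

  Σ<-*ˡ : ∀ c f n → Σ< (λ i → c * f i) n ≈ c * Σ< f n
  Σ<-*ˡ c f zero    = sym (zeroʳ c)
  Σ<-*ˡ c f (suc n) = trans (+-congʳ (Σ<-*ˡ c f n)) (sym (distribˡ c _ _))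

  Σ<-suc : ∀ f n → Σ< f (suc n) ≈ f 0 + Σ< (f ∘ suc) n
  Σ<-suc f zero    = +-comm 0# (f 0)
  Σ<-suc f (suc n) = trans (+-congʳ (Σ<-suc f n)) (+-assoc (f 0) _ _)

  Σ<-extend : ∀ {f} n d → (∀ i → 0# ≤ f i) → Σ< f n ≤ Σ< f (d ℕ.+ n)
  Σ<-extend n zero    0≤f = ≤-refl
  Σ<-extend n (suc d) 0≤f = ≤-trans (Σ<-extend n d 0≤f) (x≤x+y (0≤f _))

  infix 4 ∣_∣≤_
  -- A pair of bounds replaces the absolute value, so that no operation has to be defined by cases
  -- on a sign.
  ∣_∣≤_ : ℝ → ℝ → Set
  ∣ x ∣≤ ε = x ≤ ε × - x ≤ ε

  ∣∣≤-respˡ : ∀ {x y ε} → x ≈ y → ∣ x ∣≤ ε → ∣ y ∣≤ ε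
  ∣∣≤-respˡ eq (le₁ , le₂) = ≤-respˡ eq le₁ , ≤-respˡ (-‿cong eq) le₂

  ∣∣≤-weaken : ∀ {x ε δ} → ε ≤ δ → ∣ x ∣≤ ε → ∣ x ∣≤ δ
  ∣∣≤-weaken le (le₁ , le₂) = ≤-trans le₁ le , ≤-trans le₂ le

  ∣∣≤-neg : ∀ {x ε} → ∣ x ∣≤ ε → ∣ - x ∣≤ ε
  ∣∣≤-neg {x} (le₁ , le₂) = le₂ , ≤-respˡ (solve 1 (λ x → x := :- (:- x)) refl x) le₁

  ∣∣≤-+ : ∀ {x y ε δ} → ∣ x ∣≤ ε → ∣ y ∣≤ δ → ∣ x + y ∣≤ ε + δ
  ∣∣≤-+ {x} {y} (a , b) (c , d) = +-mono-≤ a c ,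
    ≤-respˡ (solve 2 (λ x y → :- x :+ :- y := :- (x :+ y)) refl x y) (+-mono-≤ b d)

  -- 2 (ε δ - x y) = (ε - x) (δ + y) + (ε + x) (δ - y), and likewise for - x y.
  ∣∣≤-* : ∀ {x y ε δ} → ∣ x ∣≤ ε → ∣ y ∣≤ δ → ∣ x * y ∣≤ ε * δ
  ∣∣≤-* {x} {y} {ε} {δ} (x≤ε , -x≤ε) (y≤δ , -y≤δ) =
    0≤y-x⇒x≤y (x+x≥0⇒x≥0 (≤-respʳ
      (solve 4 (λ x y ε δ → (ε :- x) :* (δ :- :- y) :+ (ε :- :- x) :* (δ :- y)
         := (ε :* δ :- x :* y) :+ (ε :* δ :- x :* y)) refl x y ε δ)
      (+-nonneg (*-nonneg (x≤y⇒0≤y-x x≤ε) (x≤y⇒0≤y-x -y≤δ))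
                (*-nonneg (x≤y⇒0≤y-x -x≤ε) (x≤y⇒0≤y-x y≤δ))))) ,
    0≤y-x⇒x≤y (x+x≥0⇒x≥0 (≤-respʳ
      (solve 4 (λ x y ε δ → (ε :- x) :* (δ :- y) :+ (ε :- :- x) :* (δ :- :- y)
         := (ε :* δ :- :- (x :* y)) :+ (ε :* δ :- :- (x :* y))) refl x y ε δ)
      (+-nonneg (*-nonneg (x≤y⇒0≤y-x x≤ε) (x≤y⇒0≤y-x y≤δ))
                (*-nonneg (x≤y⇒0≤y-x -x≤ε) (x≤y⇒0≤y-x -y≤δ)))))

  ∣∣≤-refl : ∀ {x} → 0# ≤ x → ∣ x ∣≤ x
  ∣∣≤-refl {x} 0≤x = ≤-refl , shift-≤ (+-nonneg 0≤x 0≤x)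
    (solve 1 (λ x → x :+ :0 := :- x :+ (x :+ x)) refl x)

  magnitude : ∀ x → ∃ λ X → 0# ≤ X × ∣ x ∣≤ X
  magnitude x with total 0# x
  ... | inj₁ 0≤x = x , 0≤x , ∣∣≤-refl 0≤x
  ... | inj₂ x≤0 = - x , 0≤-x x≤0 ,
    ∣∣≤-respˡ (solve 1 (λ x → :- (:- x) := x) refl x) (∣∣≤-neg (∣∣≤-refl (0≤-x x≤0)))

  ∣∣≤-Σ< : ∀ {f g} n → (∀ i → i ℕ.< n → ∣ f i ∣≤ g i) → ∣ Σ< f n ∣≤ Σ< g n
  ∣∣≤-Σ< zero    le = ∣∣≤-refl ≤-refl
  ∣∣≤-Σ< (suc n) le =
    ∣∣≤-+ (∣∣≤-Σ< n λ i i<n → le i (ℕ.m<n⇒m<1+n i<n)) (le n ℕ.≤-refl)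

  -- Sequences

  2# ½ : ℝ
  2# = 1# + 1#
  ½ = 2# ⁻¹

  0<2 : 0# < 2#
  0<2 = +-pos 0<1 0≤1

  0<½ : 0# < ½
  0<½ = ⁻¹-pos 0<2

  ½+½ : ∀ x → ½ * x + ½ * x ≈ x
  ½+½ x = begin
    ½ * x + ½ * x      ≈⟨ solve 2 (λ h x → h :* x :+ h :* x := (h :* (:1 :+ :1)) :* x) refl ½ x ⟩
    (½ * 2#) * x       ≈⟨ *-congʳ (⁻¹-inverseˡ 0<2) ⟩
    1# * x             ≈⟨ *-identityˡ x ⟩
    x                  ∎
    where open ≈-Reasoning

  ½*x<x : ∀ {x} → 0# < x → ½ * x < x
  ½*x<x {x} 0<x = ≤-respʳ (½+½ x) (x≤x+y (<⇒≤ 0<½x)) , λ eq →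
    <⇒≉ 0<½x (antisym (<⇒≤ 0<½x) (+-cancelʳ-≤ (½ * x)
      (≤-reflexive (trans (½+½ x) (trans (sym eq) (sym (+-identityˡ _)))))))
    where 0<½x = *-pos 0<½ 0<x

  Null : (ℕ → ℝ) → Set
  Null s = ∀ ε → 0# < ε → ∃ λ N → ∀ m → N ℕ.≤ m → ∣ s m ∣≤ ε

  Null-resp : ∀ {s t} → (∀ m → s m ≈ t m) → Null s → Null t
  Null-resp eq null ε 0<ε = proj₁ (null ε 0<ε) , λ m N≤m →
    ∣∣≤-respˡ (eq m) (proj₂ (null ε 0<ε) m N≤m)

  Null-neg : ∀ {s} → Null s → Null (λ m → - s m)
  Null-neg null ε 0<ε = proj₁ (null ε 0<ε) , λ m N≤m →
    ∣∣≤-neg (proj₂ (null ε 0<ε) m N≤m)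

  Null-+ : ∀ {s t} → Null s → Null t → Null (λ m → s m + t m)
  Null-+ null-s null-t ε 0<ε = proj₁ S ℕ.⊔ proj₁ T , λ m le →
    ∣∣≤-weaken (≤-reflexive (½+½ ε))
      (∣∣≤-+ (proj₂ S m (ℕ.≤-trans (ℕ.m≤m⊔n _ _) le))
             (proj₂ T m (ℕ.≤-trans (ℕ.m≤n⊔m _ _) le)))
    where
    S = null-s (½ * ε) (*-pos 0<½ 0<ε)
    T = null-t (½ * ε) (*-pos 0<½ 0<ε)

  Null-∣∣≤ : ∀ {s t} → (∀ m → ∣ s m ∣≤ t m) → Null t → Null s
  Null-∣∣≤ le null ε 0<ε = proj₁ (null ε 0<ε) , λ m N≤m →
    ∣∣≤-weaken (proj₁ (proj₂ (null ε 0<ε) m N≤m)) (le m)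

  Null-* : ∀ {s t : ℕ → ℝ} {B} → 0# ≤ B → (∀ m → ∣ t m ∣≤ B) → Null s → Null (λ m → s m * t m)
  Null-* {B = B} 0≤B t≤B null ε 0<ε = proj₁ S , λ m N≤m →
    ∣∣≤-weaken le (∣∣≤-* (proj₂ S m N≤m) (∣∣≤-weaken (x≤y+x {B} 0≤1) (t≤B m)))
    where
    0<B′ : 0# < 1# + B
    0<B′ = +-pos 0<1 0≤B
    -- Dividing by 1 + B instead of B keeps the divisor positive when B is 0.
    S = null (ε * (1# + B) ⁻¹) (*-pos 0<ε (⁻¹-pos 0<B′))
    le : ε * (1# + B) ⁻¹ * (1# + B) ≤ ε
    le = ≤-reflexive (trans (*-assoc ε _ _)
      (trans (*-congˡ (⁻¹-inverseˡ 0<B′)) (*-identityʳ ε)))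

  x≤ε⇒x≤0 : ∀ {x} → (∀ ε → 0# < ε → x ≤ ε) → x ≤ 0#
  x≤ε⇒x≤0 {x} le with em {x ≤ 0#}
  ... | yes x≤0 = x≤0
  ... | no  x≰0 = contradiction (le (½ * x) (*-pos 0<½ 0<x)) (<⇒≱ (½*x<x 0<x))
    where
    0<x : 0# < x
    0<x = ≰⇒> x≰0

  Null-const : ∀ {x y} → Null (λ _ → x - y) → x ≈ y
  Null-const {x} {y} null = antisym
    (shift-≤ (x≤ε⇒x≤0 λ ε 0<ε → let (N , le) = null ε 0<ε in proj₁ (le N ℕ.≤-refl))
      (solve 2 (λ x y → y :+ (x :- y) := x :+ :0) refl x y))
    (shift-≤ (x≤ε⇒x≤0 λ ε 0<ε → let (N , le) = null ε 0<ε in proj₂ (le N ℕ.≤-refl))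
      (solve 2 (λ x y → x :+ :- (x :- y) := y :+ :0) refl x y))

  ⟶⇒Null : ∀ {s l} → s ⟶ l → Null (λ m → s m - l)
  ⟶⇒Null {s} {l} lim ε 0<ε = proj₁ (lim ε 0<ε) , λ m N≤m →
    let (lower , upper) = proj₂ (lim ε 0<ε) m N≤m in
    shift-≤ (<⇒≤ upper) (solve 3 (λ s l ε → ε :+ s := (s :- l) :+ (l :+ ε)) refl (s m) l ε) ,
    shift-≤ (<⇒≤ lower) (solve 3 (λ s l ε → ε :+ (l :- ε) := :- (s :- l) :+ s) refl (s m) l ε)

  Null⇒⟶ : ∀ {s l} → Null (λ m → s m - l) → s ⟶ l
  Null⇒⟶ {s} {l} null ε 0<ε = proj₁ S , λ m N≤m →
    let (upper , lower) = proj₂ S m N≤m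
        upper′ = ≤-<-trans upper (½*x<x 0<ε)
        lower′ = ≤-<-trans lower (½*x<x 0<ε)
    in
    shift-< lower′ (solve 3 (λ s l ε → s :+ :- (s :- l) := (l :- ε) :+ ε) refl (s m) l ε) ,
    shift-< upper′ (solve 3 (λ s l ε → (l :+ ε) :+ (s :- l) := s :+ ε) refl (s m) l ε)
    where
    S = null (½ * ε) (*-pos 0<½ 0<ε)
    shift-< : ∀ {a b x y} → a < b → y + a ≈ x + b → x < y
    shift-< {a} {b} {x} {y} (a≤b , a≉b) eq = shift-≤ a≤b eq , λ x≈y → a≉b (antisym a≤b
      (shift-≤ (≤-reflexive x≈y) (begin
        a + x ≈⟨ +-congˡ x≈y ⟩
        a + y ≈⟨ +-comm a y ⟩
        y + a ≈⟨ eq ⟩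
        x + b ≈⟨ +-congʳ x≈y ⟩
        y + b ≈⟨ +-comm y b ⟩
        b + y ∎)))
      where open ≈-Reasoning

  record Supremum (s : ℕ → ℝ) : Set where
    field
      limit  : ℝ
      upper  : ∀ m → s m ≤ limit
      least  : ∀ u → (∀ m → s m ≤ u) → limit ≤ u
      null   : Null (λ m → s m - limit)

  monotone-limit : ∀ {s u} → (∀ m → s m ≤ s (suc m)) → (∀ m → s m ≤ u) → Supremum s
  monotone-limit {s} {u} s-mono s≤u = record
    { limit = l ; upper = s≤l ; least = λ v s≤v → l≤ v λ { x (m , x≈) → ≤-respˡ (sym x≈) (s≤v m) }
    ; null = null }
    where
    P : ℝ → Set
    P x = ∃ λ m → x ≈ s m
    sup = supremum P (s 0 , 0 , refl) (u , λ { x (m , x≈) → ≤-respˡ (sym x≈) (s≤u m) })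
    l = proj₁ sup
    s≤l : ∀ m → s m ≤ l
    s≤l m = proj₁ (proj₂ sup) (s m) (m , refl)
    l≤ = proj₂ (proj₂ sup)
    s-mono⁺ : ∀ m d → s m ≤ s (d ℕ.+ m)
    s-mono⁺ m zero    = ≤-refl
    s-mono⁺ m (suc d) = ≤-trans (s-mono⁺ m d) (s-mono (d ℕ.+ m))
    null : Null (λ m → s m - l)
    null ε 0<ε with em {∃ λ N → l - ε ≤ s N}
    ... | yes (N , le) = N , λ m N≤m →
      shift-≤ (+-mono-≤ (s≤l m) (<⇒≤ 0<ε))
        (solve 3 (λ s l ε → ε :+ (s :+ :0) := (s :- l) :+ (l :+ ε)) refl (s m) l ε) ,
      shift-≤ (≤-trans le (≡.subst (λ k → s N ≤ s k) (ℕ.m∸n+n≡m N≤m) (s-mono⁺ N (m ℕ.∸ N))))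
        (solve 3 (λ s l ε → ε :+ (l :- ε) := :- (s :- l) :+ s) refl (s m) l ε)
    ... | no  none = contradiction
      (l≤ (l - ε) λ { x (m , x≈) → ≤-respˡ (sym x≈) (<⇒≤ (≰⇒> λ le → none (m , le))) })
      (<⇒≱ (shift-≤ (<⇒≤ 0<ε) (solve 2 (λ l ε → l :+ :0 := (l :- ε) :+ ε) refl l ε) , λ eq →
        <⇒≉ 0<ε (begin
          0#            ≈⟨ -‿inverseʳ l ⟨
          l - l         ≈⟨ +-congˡ (-‿cong eq) ⟨
          l - (l - ε)   ≈⟨ solve 2 (λ l ε → l :- (l :- ε) := ε) refl l ε ⟩
          ε             ∎)))
      where open ≈-Reasoning

  -- The exponential series

  term : ℝ → ℕ → ℝ
  term x k = x ^ k * factorial k ⁻¹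

  factorial-pos : ∀ k → 0# < factorial k
  factorial-pos zero    = 0<1
  factorial-pos (suc k) = *-pos (fromℕ-pos k) (factorial-pos k)

  term-0 : ∀ x → term x 0 ≈ 1#
  term-0 x = ⁻¹-inverseʳ 1# (pos⇒≉0 0<1)

  term-suc : ∀ x k → fromℕ (suc k) * term x (suc k) ≈ x * term x k
  term-suc x k = begin
    N * (x * p * i)            ≈⟨ *-identityʳ _ ⟨
    N * (x * p * i) * 1#       ≈⟨ *-congˡ (⁻¹-inverseʳ f (pos⇒≉0 (factorial-pos k))) ⟨
    N * (x * p * i) * (f * j)  ≈⟨ solve 6 (λ N x p i f j →
                                    N :* (x :* p :* i) :* (f :* j) := (x :* (p :* j)) :* ((N :* f) :* i))
                                    refl N x p i f j ⟩
    x * (p * j) * (N * f * i)  ≈⟨ *-congˡ (⁻¹-inverseʳ (N * f) (pos⇒≉0 (factorial-pos (suc k)))) ⟩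
    x * (p * j) * 1#           ≈⟨ *-identityʳ _ ⟩
    x * (p * j)                ∎
    where
    open ≈-Reasoning
    N = fromℕ (suc k)
    f = factorial k
    i = (N * f) ⁻¹
    j = f ⁻¹
    p = x ^ k

  term-cong : ∀ {x y} k → x ≈ y → term x k ≈ term y k
  term-cong k x≈y = *-congʳ (Algebra.Properties.Semiring.Exp.^-congˡ semiring k x≈y)

  term-nonneg : ∀ {x} k → 0# ≤ x → 0# ≤ term x k
  term-nonneg k 0≤x = *-nonneg (^-nonneg k 0≤x) (⁻¹-nonneg (factorial-pos k))

  ∣^∣≤ : ∀ {x X} k → ∣ x ∣≤ X → ∣ x ^ k ∣≤ X ^ k
  ∣^∣≤ zero    le = ∣∣≤-refl 0≤1
  ∣^∣≤ (suc k) le = ∣∣≤-* le (∣^∣≤ k le)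

  ∣term∣≤ : ∀ {x X} k → ∣ x ∣≤ X → ∣ term x k ∣≤ term X k
  ∣term∣≤ k le = ∣∣≤-* (∣^∣≤ k le) (∣∣≤-refl (⁻¹-nonneg (factorial-pos k)))

  -- The binomial theorem divided by n!. For the induction step the sum is multiplied by n + 1 = i +
  -- (n + 1 - i): the first part lowers the index of the x-factor, the second that of the y-factor,
  -- and both leave the sum for n.
  binomial : ∀ x y n → Σ< (λ i → term x i * term y (n ℕ.∸ i)) (suc n) ≈ term (x + y) n
  binomial x y zero    = begin
    0# + term x 0 * term y 0  ≈⟨ +-identityˡ _ ⟩
    term x 0 * term y 0       ≈⟨ *-cong (term-0 x) (term-0 y) ⟩
    1# * 1#                   ≈⟨ *-identityʳ 1# ⟩
    1#                        ≈⟨ term-0 (x + y) ⟨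
    term (x + y) 0            ∎
    where open ≈-Reasoning
  binomial x y (suc n) = *-cancelʳ-≈ (fromℕ-pos n) (trans (*-comm _ N) (trans scaled (*-comm N _)))
    where
    open ≈-Reasoning
    N = fromℕ (suc n)
    c = λ i → term x i * term y (n ℕ.∸ i)
    a = λ i → fromℕ i * term x i * term y (suc n ℕ.∸ i)
    b = λ i → term x i * (fromℕ (suc n ℕ.∸ i) * term y (suc n ℕ.∸ i))

    split : ∀ i → i ℕ.< suc (suc n) → N * (term x i * term y (suc n ℕ.∸ i)) ≈ a i + b i
    split i (ℕ.s≤s i≤) = begin
      N * (s * t)                                  ≡⟨ ≡.cong (λ k → fromℕ k * (s * t)) (ℕ.m+[n∸m]≡n i≤) ⟨
      fromℕ (i ℕ.+ (suc n ℕ.∸ i)) * (s * t)        ≈⟨ *-congʳ (fromℕ-+ i _) ⟩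
      (fromℕ i + fromℕ (suc n ℕ.∸ i)) * (s * t)    ≈⟨ solve 4 (λ p q s t → (p :+ q) :* (s :* t)
                                                        := p :* s :* t :+ s :* (q :* t)) refl _ _ s t ⟩
      a i + b i                                    ∎
      where
      s = term x i
      t = term y (suc n ℕ.∸ i)

    a-sum : Σ< a (suc (suc n)) ≈ x * Σ< c (suc n)
    a-sum = begin
      Σ< a (suc (suc n))           ≈⟨ Σ<-suc a (suc n) ⟩
      a 0 + Σ< (a ∘ suc) (suc n)   ≈⟨ +-cong (trans (*-assoc _ _ _) (zeroˡ _))
                                        (Σ<-cong (suc n) λ i _ → trans (*-congʳ (term-suc x i)) (*-assoc x _ _)) ⟩
      0# + Σ< (λ i → x * c i) (suc n)  ≈⟨ +-identityˡ _ ⟩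
      Σ< (λ i → x * c i) (suc n)   ≈⟨ Σ<-*ˡ x c (suc n) ⟩
      x * Σ< c (suc n)             ∎

    b-step : ∀ i → i ℕ.< suc n → b i ≈ y * c i
    b-step i (ℕ.s≤s i≤n) = begin
      b i  ≡⟨ ≡.cong (λ k → term x i * (fromℕ k * term y k)) (ℕ.+-∸-assoc 1 i≤n) ⟩
      term x i * (fromℕ (suc (n ℕ.∸ i)) * term y (suc (n ℕ.∸ i)))  ≈⟨ *-congˡ (term-suc y (n ℕ.∸ i)) ⟩
      term x i * (y * term y (n ℕ.∸ i))  ≈⟨ solve 3 (λ s y t → s :* (y :* t) := y :* (s :* t)) refl _ y _ ⟩
      y * c i ∎

    b-last : b (suc n) ≈ 0#
    b-last = begin
      b (suc n)  ≡⟨ ≡.cong (λ k → term x (suc n) * (fromℕ k * term y k)) (ℕ.n∸n≡0 n) ⟩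
      term x (suc n) * (0# * term y 0)  ≈⟨ *-congˡ (zeroˡ _) ⟩
      term x (suc n) * 0#               ≈⟨ zeroʳ _ ⟩
      0#                                ∎

    scaled : N * Σ< (λ i → term x i * term y (suc n ℕ.∸ i)) (suc (suc n)) ≈ N * term (x + y) (suc n)
    scaled = begin
      N * Σ< _ (suc (suc n))                           ≈⟨ Σ<-*ˡ N (λ i → term x i * term y (suc n ℕ.∸ i)) (suc (suc n)) ⟨
      Σ< _ (suc (suc n))                               ≈⟨ Σ<-cong {g = λ i → a i + b i} (suc (suc n)) split ⟩
      Σ< (λ i → a i + b i) (suc (suc n))               ≈⟨ Σ<-+ a b (suc (suc n)) ⟩
      Σ< a (suc (suc n)) + (Σ< b (suc n) + b (suc n))  ≈⟨ +-cong a-sum (+-cong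
                                                            (trans (Σ<-cong (suc n) b-step) (Σ<-*ˡ y c (suc n))) b-last) ⟩
      x * Σ< c (suc n) + (y * Σ< c (suc n) + 0#)       ≈⟨ solve 3 (λ x y z → x :* z :+ (y :* z :+ :0) := (x :+ y) :* z) refl x y _ ⟩
      (x + y) * Σ< c (suc n)                           ≈⟨ *-congˡ (binomial x y n) ⟩
      (x + y) * term (x + y) n                         ≈⟨ term-suc (x + y) n ⟨
      N * term (x + y) (suc n)                         ∎

  -- Both sides add the products of terms with i + j < m: the left one by rows i, the right one by
  -- total degree, where `binomial` applies.
  triangle : ∀ x y m → Σ< (λ i → term x i * E y (m ℕ.∸ i)) m ≈ E (x + y) m
  triangle x y zero    = refl
  triangle x y (suc m) = begin
    Σ< (λ i → term x i * E y (suc m ℕ.∸ i)) (suc m)            ≈⟨ Σ<-cong (suc m) split ⟩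
    Σ< (λ i → u i + v i) (suc m)                               ≈⟨ Σ<-+ u v (suc m) ⟩
    (Σ< u m + term x m * E y (m ℕ.∸ m)) + Σ< v (suc m)         ≈⟨ +-cong (+-cong (triangle x y m) last) (binomial x y m) ⟩
    (E (x + y) m + 0#) + term (x + y) m                        ≈⟨ +-congʳ (+-identityʳ _) ⟩
    E (x + y) m + term (x + y) m                               ∎
    where
    open ≈-Reasoning
    u = λ i → term x i * E y (m ℕ.∸ i)
    v = λ i → term x i * term y (m ℕ.∸ i)
    split : ∀ i → i ℕ.< suc m → term x i * E y (suc m ℕ.∸ i) ≈ u i + v i
    split i (ℕ.s≤s i≤m) = trans
      (reflexive (≡.cong (λ k → term x i * E y k) (ℕ.+-∸-assoc 1 i≤m)))
      (distribˡ _ _ _)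
    last : term x m * E y (m ℕ.∸ m) ≈ 0#
    last = trans (reflexive (≡.cong (λ k → term x m * E y k) (ℕ.n∸n≡0 m))) (zeroʳ _)

  E-cong : ∀ {x y} m → x ≈ y → E x m ≈ E y m
  E-cong zero    x≈y = refl
  E-cong (suc m) x≈y = +-cong (E-cong m x≈y) (term-cong m x≈y)

  E-as-Σ< : ∀ x m → E x m ≈ Σ< (term x) m
  E-as-Σ< x zero    = refl
  E-as-Σ< x (suc m) = +-congʳ (E-as-Σ< x m)

  E-mono : ∀ {x} m d → 0# ≤ x → E x m ≤ E x (d ℕ.+ m)
  E-mono m zero    0≤x = ≤-refl
  E-mono m (suc d) 0≤x = ≤-trans (E-mono m d 0≤x) (x≤x+y (term-nonneg (d ℕ.+ m) 0≤x))

  E-nonneg : ∀ {x} m → 0# ≤ x → 0# ≤ E x m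
  E-nonneg m 0≤x = ≡.subst (λ k → 0# ≤ E _ k) (ℕ.+-identityʳ m) (E-mono 0 m 0≤x)

  ∣E∣≤ : ∀ {x X} m → ∣ x ∣≤ X → ∣ E x m ∣≤ E X m
  ∣E∣≤ zero    le = ∣∣≤-refl ≤-refl
  ∣E∣≤ (suc m) le = ∣∣≤-+ (∣E∣≤ m le) (∣term∣≤ m le)

  ∣E-tail∣≤ : ∀ {x X} r d → ∣ x ∣≤ X → ∣ E x (d ℕ.+ r) - E x r ∣≤ E X (d ℕ.+ r) - E X r
  ∣E-tail∣≤ {x} {X} r zero    le =
    ∣∣≤-respˡ (sym (-‿inverseʳ _)) (∣∣≤-weaken (≤-reflexive (sym (-‿inverseʳ _))) (∣∣≤-refl ≤-refl))
  ∣E-tail∣≤ {x} {X} r (suc d) le = ∣∣≤-respˡ (swap _ _ _)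
    (∣∣≤-weaken (≤-reflexive (swap _ _ _)) (∣∣≤-+ (∣E-tail∣≤ r d le) (∣term∣≤ (d ℕ.+ r) le)))
    where
    swap : ∀ a b c → (a - b) + c ≈ (a + c) - b
    swap = solve 3 (λ a b c → (a :- b) :+ c := (a :+ c) :- b) refl

  -- The difference collects the products of terms of total degree at least m.
  defect : ∀ x y m → E x m * E y m - E (x + y) m
                     ≈ Σ< (λ i → term x i * (E y m - E y (m ℕ.∸ i))) m
  defect x y m = sym (begin
    Σ< (λ i → term x i * (E y m - E y (m ℕ.∸ i))) m
      ≈⟨ Σ<-cong m (λ i _ → solve 3 (λ t a b → t :* (a :- b) := a :* t :+ (:- :1) :* (t :* b)) refl _ _ _) ⟩
    Σ< (λ i → E y m * term x i + - 1# * (term x i * E y (m ℕ.∸ i))) m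
      ≈⟨ Σ<-+ _ _ m ⟩
    Σ< (λ i → E y m * term x i) m + Σ< (λ i → - 1# * (term x i * E y (m ℕ.∸ i))) m
      ≈⟨ +-cong (trans (Σ<-*ˡ _ _ m) (*-congˡ (sym (E-as-Σ< x m))))
                (trans (Σ<-*ˡ _ _ m) (*-congˡ (triangle x y m))) ⟩
    E y m * E x m + - 1# * E (x + y) m
      ≈⟨ solve 3 (λ a b c → b :* a :+ :- :1 :* c := a :* b :- c) refl _ _ _ ⟩
    E x m * E y m - E (x + y) m  ∎)
    where open ≈-Reasoning

  -- The defect is a sum of products of terms and tails, each dominated by its counterpart for X and
  -- Y. Signed arguments are thus reduced to nonnegative ones.
  ∣defect∣≤ : ∀ {x X y Y} m → ∣ x ∣≤ X → ∣ y ∣≤ Y →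
    ∣ E x m * E y m - E (x + y) m ∣≤ E X m * E Y m - E (X + Y) m
  ∣defect∣≤ {x} {X} {y} {Y} m x≤X y≤Y = ∣∣≤-respˡ (sym (defect x y m))
    (∣∣≤-weaken (≤-reflexive (sym (defect X Y m))) (∣∣≤-Σ< m λ i i<m →
      ∣∣≤-* (∣term∣≤ i x≤X)
        (≡.subst (λ k → ∣ E y k - E y (m ℕ.∸ i) ∣≤ E Y k - E Y (m ℕ.∸ i))
          (ℕ.m+[n∸m]≡n (ℕ.<⇒≤ i<m)) (∣E-tail∣≤ (m ℕ.∸ i) i y≤Y))))

  -- For nonnegative arguments `∣defect∣≤` bounds the defect d by itself, and - d ≤ d forces d ≥ 0.
  E-+-≤ : ∀ {x y} m → 0# ≤ x → 0# ≤ y → E (x + y) m ≤ E x m * E y m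
  E-+-≤ m 0≤x 0≤y = 0≤y-x⇒x≤y
    (x+x≥0⇒x≥0 (shift-≤ (proj₂ (∣defect∣≤ m (∣∣≤-refl 0≤x) (∣∣≤-refl 0≤y)))
      (solve 1 (λ d → (d :+ d) :+ (:- d) := :0 :+ d) refl _)))

  -- The square i, j < m lies inside the triangle i + j < 2 m.
  E-+-≥ : ∀ {x y} m → 0# ≤ x → 0# ≤ y → E x m * E y m ≤ E (x + y) (m ℕ.+ m)
  E-+-≥ {x} {y} m 0≤x 0≤y = begin
    E x m * E y m                                       ≈⟨ trans (*-congʳ (E-as-Σ< x m)) (*-comm _ _) ⟩
    E y m * Σ< (term x) m                               ≈⟨ Σ<-*ˡ _ _ m ⟨
    Σ< (λ i → E y m * term x i) m                       ≤⟨ Σ<-mono m (λ i i<m → ≤-respˡ (*-comm _ _)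
                                                             (*-monoʳ-≤ (term-nonneg i 0≤x) (bound i i<m))) ⟩
    Σ< (λ i → term x i * E y (m ℕ.+ m ℕ.∸ i)) m         ≤⟨ Σ<-extend m m (λ i → *-nonneg (term-nonneg i 0≤x)
                                                             (E-nonneg (m ℕ.+ m ℕ.∸ i) 0≤y)) ⟩
    Σ< (λ i → term x i * E y (m ℕ.+ m ℕ.∸ i)) (m ℕ.+ m) ≈⟨ triangle x y (m ℕ.+ m) ⟩
    E (x + y) (m ℕ.+ m)                                 ∎
    where
    open ≤-Reasoning
    bound : ∀ i → i ℕ.< m → E y m ≤ E y (m ℕ.+ m ℕ.∸ i)
    bound i i<m = ≡.subst (λ k → E y m ≤ E y k)
      (≡.trans (ℕ.+-comm _ m) (≡.sym (ℕ.+-∸-assoc m (ℕ.<⇒≤ i<m))))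
      (E-mono m (m ℕ.∸ i) 0≤y)

  term≤^ : ∀ {x} k → 0# ≤ x → term x k ≤ x ^ k
  term≤^ {x} k 0≤x = x*y⁻¹≤z (factorial-pos k)
    (≤-respˡ (*-identityʳ _) (*-monoʳ-≤ (^-nonneg k 0≤x) (1≤factorial k)))
    where
    1≤factorial : ∀ k → 1# ≤ factorial k
    1≤factorial zero    = ≤-refl
    1≤factorial (suc k) = ≤-respˡ (*-identityˡ 1#)
      (*-mono-≤ 0≤1 0≤1 (1≤fromℕ {suc k} (ℕ.s≤s ℕ.z≤n)) (1≤factorial k))

  -- Comparison with the geometric series, stated without division so that x = 1 is allowed.
  E-geometric : ∀ {x} m → 0# ≤ x → x ≤ 1# → E x m * (1# - x) ≤ 1#
  E-geometric {x} m 0≤x x≤1 = ≤-trans (go m)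
    (shift-≤ (^-nonneg m 0≤x) (solve 1 (λ p → :1 :+ :0 := (:1 :- p) :+ p) refl _))
    where
    go : ∀ m → E x m * (1# - x) ≤ 1# - x ^ m
    go zero    = ≤-reflexive (solve 1 (λ x → :0 :* (:1 :- x) := :1 :- :1) refl x)
    go (suc m) = shift-≤ (+-mono-≤ (go m) (*-monoˡ-≤ (x≤y⇒0≤y-x x≤1) (term≤^ m 0≤x)))
      (solve 4 (λ x E t p → (:1 :- x :* p) :+ (E :* (:1 :- x) :+ t :* (:1 :- x))
         := (E :+ t) :* (:1 :- x) :+ ((:1 :- p) :+ p :* (:1 :- x))) refl x (E x m) (term x m) (x ^ m))

  -- Take N with x ≤ N/2. The geometric comparison gives 2 as a bound at ½, and by `E-+-≤` each
  -- further step of ½ costs one more factor 2.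
  E-bounded : ∀ {x} → 0# ≤ x → ∃ λ u → ∀ m → E x m ≤ u
  E-bounded {x} 0≤x with archimedean (2# * x)
  ... | N , 2x≤N = let (u , le) = bound N in u , λ m → ≤-trans (mono m) (le m)
    where
    open ≤-Reasoning

    x≤N½ : x ≤ fromℕ N * ½
    x≤N½ = begin
      x                ≈⟨ ½+½ x ⟨
      ½ * x + ½ * x    ≈⟨ solve 2 (λ h x → h :* x :+ h :* x := (:1 :+ :1) :* x :* h) refl ½ x ⟩
      2# * x * ½       ≤⟨ *-monoˡ-≤ (<⇒≤ 0<½) 2x≤N ⟩
      fromℕ N * ½      ∎

    mono : ∀ m → E x m ≤ E (fromℕ N * ½) m
    mono m = proj₁ (∣E∣≤ m (x≤N½ , ≤-trans (proj₂ (∣∣≤-refl 0≤x)) x≤N½))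

    E½≤2 : ∀ m → E ½ m ≤ 2#
    E½≤2 m = begin
      E ½ m                            ≈⟨ ½+½ _ ⟨
      ½ * E ½ m + ½ * E ½ m            ≈⟨ solve 2 (λ h e → h :* e :+ h :* e := (:1 :+ :1) :* (e :* h)) refl ½ _ ⟩
      2# * (E ½ m * ½)                 ≈⟨ *-congˡ (*-congˡ half) ⟨
      2# * (E ½ m * (1# - ½))          ≤⟨ *-monoʳ-≤ (<⇒≤ 0<2) (E-geometric m (<⇒≤ 0<½) ½≤1) ⟩
      2# * 1#                          ≈⟨ *-identityʳ 2# ⟩
      2#                               ∎
      where
      1≈½+½ : ½ + ½ ≈ 1#
      1≈½+½ = trans (+-cong (sym (*-identityʳ ½)) (sym (*-identityʳ ½))) (½+½ 1#)
      half : 1# - ½ ≈ ½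
      half = trans (+-congʳ (sym 1≈½+½)) (solve 1 (λ h → (h :+ h) :- h := h) refl ½)
      ½≤1 : ½ ≤ 1#
      ½≤1 = ≤-respʳ 1≈½+½ (x≤x+y (<⇒≤ 0<½))

    bound : ∀ n → ∃ λ u → ∀ m → E (fromℕ n * ½) m ≤ u
    bound zero    = 2# , λ m → ≤-trans
      (proj₁ (∣E∣≤ m (≤-trans (≤-reflexive (zeroˡ ½)) (<⇒≤ 0<½) ,
        shift-≤ (<⇒≤ 0<½) (solve 1 (λ h → h :+ :0 := :- (:0 :* h) :+ h) refl ½))))
      (E½≤2 m)
    bound (suc n) = 2# * u , λ m → begin
      E (fromℕ (suc n) * ½) m        ≈⟨ E-cong m (trans (distribʳ ½ 1# _) (+-congʳ (*-identityˡ ½))) ⟩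
      E (½ + fromℕ n * ½) m          ≤⟨ E-+-≤ m (<⇒≤ 0<½) 0≤n½ ⟩
      E ½ m * E (fromℕ n * ½) m      ≤⟨ *-mono-≤ (E-nonneg m (<⇒≤ 0<½)) (E-nonneg m 0≤n½) (E½≤2 m) (le m) ⟩
      2# * u                         ∎
      where
      u = proj₁ (bound n)
      le = proj₂ (bound n)
      0≤n½ = *-nonneg (fromℕ-nonneg n) (<⇒≤ 0<½)

  E-supremum : ∀ {x} → 0# ≤ x → Supremum (E x)
  E-supremum 0≤x = monotone-limit (λ m → E-mono m 1 0≤x) (proj₂ (E-bounded 0≤x))

  -- Adding E X to E x gives a monotone sequence, since term x k + term X k is nonnegative.
  E-converges : ∀ x → ∃ λ l → Null (λ m → E x m - l)
  E-converges x = S.limit - T.limit , Null-resp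
    (λ m → solve 4 (λ a b s t → (a :+ b :- s) :+ :- (b :- t) := a :- (s :- t)) refl _ _ _ _)
    (Null-+ S.null (Null-neg T.null))
    where
    X = proj₁ (magnitude x)
    0≤X = proj₁ (proj₂ (magnitude x))
    x≤X = proj₂ (proj₂ (magnitude x))
    module T = Supremum (E-supremum 0≤X)
    module S = Supremum (monotone-limit {λ m → E x m + E X m} {T.limit + T.limit}
      (λ m → shift-≤ (proj₂ (∣term∣≤ m x≤X))
        (solve 4 (λ a b s t → ((a :+ s) :+ (b :+ t)) :+ :- s := (a :+ b) :+ t) refl _ _ _ _))
      (λ m → ≤-trans (+-monoˡ-≤ _ (proj₁ (∣E∣≤ m x≤X))) (+-mono-≤ (T.upper m) (T.upper m))))

  the-spec : ∀ {P : ℝ → Set} → ∃ P → P (the P)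
  the-spec {P} found with em {∃ P}
  ... | yes (x , Px) = Px
  ... | no  none     = contradiction found none

  exp-null : ∀ x → Null (λ m → E x m - exp x)
  exp-null x = ⟶⇒Null (the-spec {E x ⟶_}
    (proj₁ (E-converges x) , Null⇒⟶ (proj₂ (E-converges x))))

  exp-unique : ∀ {x l} → Null (λ m → E x m - l) → exp x ≈ l
  exp-unique {x} null = Null-const (Null-resp
    (λ m → solve 3 (λ a b c → (a :- b) :+ :- (a :- c) := c :- b) refl _ _ _)
    (Null-+ null (Null-neg (exp-null x))))

  module _ {x} (0≤x : 0# ≤ x) where
    private module S = Supremum (E-supremum 0≤x)

    E≤exp : ∀ m → E x m ≤ exp x
    E≤exp m = ≤-respʳ (sym (exp-unique S.null)) (S.upper m)

    exp-least : ∀ u → (∀ m → E x m ≤ u) → exp x ≤ u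
    exp-least u le = ≤-respˡ (sym (exp-unique S.null)) (S.least u le)

  exp-cong : ∀ {x y} → x ≈ y → exp x ≈ exp y
  exp-cong {x} {y} x≈y = exp-unique (Null-resp (λ m → +-congʳ (E-cong m (sym x≈y))) (exp-null y))

  -- E x m * E y m tends to exp x * exp y, and the defect vanishes: in absolute value it is at most
  -- the defect of the magnitudes X and Y, which by `E-+-≥` is at most exp (X + Y) - E (X + Y) m.
  exp-+ : ∀ x y → exp (x + y) ≈ exp x * exp y
  exp-+ x y = sym (Null-const (Null-resp
    (λ m → solve 6 (λ a b c d e f →
      (:- ((a :- c) :* b :+ (b :- d) :* c) :+ (a :* b :- e)) :+ (e :- f) := c :* d :- f)
      refl (E x m) (E y m) (exp x) (exp y) (E (x + y) m) (exp (x + y)))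
    (Null-+ (Null-+ (Null-neg product-limit) defect-null) (exp-null (x + y)))))
    where
    X = proj₁ (magnitude x)
    0≤X = proj₁ (proj₂ (magnitude x))
    x≤X = proj₂ (proj₂ (magnitude x))
    Y = proj₁ (magnitude y)
    0≤Y = proj₁ (proj₂ (magnitude y))
    y≤Y = proj₂ (proj₂ (magnitude y))
    C = magnitude (exp x)
    0≤X+Y = +-nonneg 0≤X 0≤Y
    product-limit : Null (λ m → (E x m - exp x) * E y m + (E y m - exp y) * exp x)
    product-limit = Null-+
      (Null-* (≤-trans (E-nonneg 0 0≤Y) (E≤exp 0≤Y 0))
        (λ m → ∣∣≤-weaken (E≤exp 0≤Y m) (∣E∣≤ m y≤Y)) (exp-null x))
      (Null-* (proj₁ (proj₂ C)) (λ m → proj₂ (proj₂ C)) (exp-null y))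
    defect-null : Null (λ m → E x m * E y m - E (x + y) m)
    defect-null = Null-∣∣≤
      (λ m → ∣∣≤-weaken
        (shift-≤ (≤-trans (E-+-≥ m 0≤X 0≤Y) (E≤exp 0≤X+Y (m ℕ.+ m)))
          (solve 3 (λ a b c → :- (b :- c) :+ a := (a :- b) :+ c) refl _ _ _))
        (∣defect∣≤ m x≤X y≤Y))
      (Null-neg (exp-null (X + Y)))

  -- Consequences of 1 + x ≤ exp x: monotonicity, powers, logarithms.

  1+x≤exp-nonneg : ∀ {x} → 0# ≤ x → 1# + x ≤ exp x
  1+x≤exp-nonneg {x} 0≤x = begin
    1# + x                               ≈⟨ +-cong (term-0 x) term-1 ⟨
    term x 0 + term x 1                  ≈⟨ +-congʳ (+-identityˡ _) ⟨
    E x 2                                ≤⟨ E≤exp 0≤x 2 ⟩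
    exp x                                ∎
    where
    open ≤-Reasoning
    term-1 : term x 1 ≈ x
    term-1 = begin-equality
      term x 1            ≈⟨ solve 1 (λ t → t := (:1 :+ :0) :* t) refl _ ⟩
      fromℕ 1 * term x 1  ≈⟨ term-suc x 0 ⟩
      x * term x 0        ≈⟨ *-congˡ (term-0 x) ⟩
      x * 1#              ≈⟨ *-identityʳ x ⟩
      x                   ∎

  exp-0 : exp 0# ≈ 1#
  exp-0 = *-cancelʳ-≈ 0<exp0 (begin
    exp 0# * exp 0#     ≈⟨ exp-+ 0# 0# ⟨
    exp (0# + 0#)       ≈⟨ exp-cong (+-identityˡ 0#) ⟩
    exp 0#              ≈⟨ *-identityˡ _ ⟨
    1# * exp 0#         ∎)
    where
    open ≈-Reasoning
    0<exp0 : 0# < exp 0#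
    0<exp0 = <-≤-trans 0<1 (≤-respˡ (+-identityʳ 1#) (1+x≤exp-nonneg ≤-refl))

  exp*exp-neg : ∀ x → exp x * exp (- x) ≈ 1#
  exp*exp-neg x = trans (sym (exp-+ x (- x))) (trans (exp-cong (-‿inverseʳ x)) exp-0)

  exp-pos : ∀ x → 0# < exp x
  exp-pos x = ≤-respʳ (trans (sym (exp-+ _ _)) (exp-cong (½+½ x))) (square-nonneg (exp (½ * x))) ,
    λ 0≈exp → 0≉1 (trans (sym (zeroˡ _)) (trans (*-congʳ 0≈exp) (exp*exp-neg x)))

  -- For -1 < x < 0 the geometric comparison bounds exp (- x) by 1 / (1 + x). This inequality does
  -- the work of calculus below: order and continuity arguments for `exp` go through it.
  1+x≤exp : ∀ x → 1# + x ≤ exp x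
  1+x≤exp x with total 0# x
  ... | inj₁ 0≤x = 1+x≤exp-nonneg 0≤x
  ... | inj₂ x≤0 with total (1# + x) 0#
  ...   | inj₁ 1+x≤0 = ≤-trans 1+x≤0 (<⇒≤ (exp-pos x))
  ...   | inj₂ 0≤1+x = *-cancelˡ-≤ (exp-pos (- x)) (begin
    exp (- x) * (1# + x)      ≤⟨ *-exp≤1 ⟩
    1#                        ≈⟨ trans (*-comm _ _) (exp*exp-neg x) ⟨
    exp (- x) * exp x         ∎)
    where
    open ≤-Reasoning
    y = - x
    0≤y = 0≤-x x≤0
    *-exp≤1 : exp y * (1# + x) ≤ 1#
    *-exp≤1 with em {0# ≈ 1# + x}
    ... | yes eq = ≤-respˡ (sym (trans (*-congˡ (sym eq)) (zeroʳ _))) 0≤1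
    ... | no neq = begin
      exp y * (1# + x)                ≤⟨ *-monoˡ-≤ 0≤1+x (exp-least 0≤y _ λ m → z≤x*y⁻¹ 0<1+x (begin
        E y m * (1# + x)                ≈⟨ *-congˡ (solve 1 (λ x → :1 :+ x := :1 :- (:- x)) refl x) ⟩
        E y m * (1# - y)                ≤⟨ E-geometric m 0≤y (shift-≤ 0≤1+x
                                             (solve 1 (λ x → :1 :+ :0 := :- x :+ (:1 :+ x)) refl x)) ⟩
        1#                              ∎)) ⟩
      1# * (1# + x) ⁻¹ * (1# + x)     ≈⟨ trans (*-assoc _ _ _) (trans (*-identityˡ _) (⁻¹-inverseˡ 0<1+x)) ⟩
      1#                              ∎
      where
      0<1+x : 0# < 1# + x
      0<1+x = 0≤1+x , neq

  exp-reflects-≤ : ∀ {x y} → exp x ≤ exp y → x ≤ y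
  exp-reflects-≤ {x} {y} le = shift-≤ (*-cancelˡ-≤ (exp-pos y) (begin
    exp y * (1# + (x - y))   ≤⟨ *-monoʳ-≤ (<⇒≤ (exp-pos y)) (1+x≤exp (x - y)) ⟩
    exp y * exp (x - y)      ≈⟨ exp-+ y (x - y) ⟨
    exp (y + (x - y))        ≈⟨ exp-cong (solve 2 (λ x y → y :+ (x :- y) := x) refl x y) ⟩
    exp x                    ≤⟨ le ⟩
    exp y                    ≈⟨ *-identityʳ _ ⟨
    exp y * 1#               ∎))
    (solve 2 (λ x y → y :+ (:1 :+ (x :- y)) := x :+ :1) refl x y)
    where open ≤-Reasoning

  exp-mono-≤ : ∀ {x y} → x ≤ y → exp x ≤ exp y
  exp-mono-≤ {x} {y} x≤y = begin
    exp x                 ≈⟨ *-identityʳ _ ⟨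
    exp x * 1#            ≤⟨ *-monoʳ-≤ (<⇒≤ (exp-pos x)) (≤-trans (x≤x+y (x≤y⇒0≤y-x x≤y)) (1+x≤exp _)) ⟩
    exp x * exp (y - x)   ≈⟨ exp-+ x (y - x) ⟨
    exp (x + (y - x))     ≈⟨ exp-cong (solve 2 (λ x y → x :+ (y :- x) := y) refl x y) ⟩
    exp y                 ∎
    where open ≤-Reasoning

  exp-^ : ∀ x k → exp x ^ k ≈ exp (fromℕ k * x)
  exp-^ x zero    = sym (trans (exp-cong (zeroˡ x)) exp-0)
  exp-^ x (suc k) = begin
    exp x * exp x ^ k             ≈⟨ *-congˡ (exp-^ x k) ⟩
    exp x * exp (fromℕ k * x)     ≈⟨ exp-+ x _ ⟨
    exp (x + fromℕ k * x)         ≈⟨ exp-cong (solve 2 (λ x k → x :+ k :* x := (:1 :+ k) :* x) refl x _) ⟩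
    exp (fromℕ (suc k) * x)       ∎
    where open ≈-Reasoning

  -- The supremum s of all x with exp x ≤ y satisfies exp s ≈ y, because
  -- exp (s ± ε) is compared with y through 1 - ε ≤ exp (- ε).
  exp-surjective : ∀ {y} → 1# ≤ y → ∃ λ x → exp x ≈ y
  exp-surjective {y} 1≤y = s , antisym upper lower
    where
    open ≤-Reasoning
    P : ℝ → Set
    P x = exp x ≤ y
    sup = supremum P (0# , ≤-respˡ (sym exp-0) 1≤y)
      (y , λ x Px → ≤-trans (x≤y+x {x} 0≤1) (≤-trans (1+x≤exp x) Px))
    s = proj₁ sup
    P≤s = proj₁ (proj₂ sup)
    s≤ = proj₂ (proj₂ sup)
    0<y = <-≤-trans 0<1 1≤y

    upper : exp s ≤ y
    upper = 0≤y-x⇒x≤y (begin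
      0#                    ≈⟨ zeroʳ (exp s) ⟨
      exp s * 0#            ≤⟨ *-monoʳ-≤ (<⇒≤ (exp-pos s)) (0≤-x (shift-≤ (s≤ (s - d) below)
                                 (solve 2 (λ s d → :0 :+ s := d :+ (s :- d)) refl s d))) ⟩
      exp s * - d           ≈⟨ solve 3 (λ e y i → e :* :- ((e :- y) :* i) := (e :* i) :* (y :- e)) refl (exp s) y i ⟩
      exp s * i * (y - exp s)   ≈⟨ trans (*-congʳ (⁻¹-inverseʳ _ (pos⇒≉0 (exp-pos s)))) (*-identityˡ _) ⟩
      y - exp s             ∎)
      where
      i = exp s ⁻¹
      d = (exp s - y) * i
      below : UpperBound P (s - d)
      below x Px = exp-reflects-≤ (begin
        exp x                      ≤⟨ Px ⟩
        y                          ≈⟨ solve 2 (λ e y → y := e :- :1 :* (e :- y)) refl (exp s) y ⟩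
        exp s - 1# * (exp s - y)   ≈⟨ +-congˡ (-‿cong (*-congʳ (⁻¹-inverseʳ _ (pos⇒≉0 (exp-pos s))))) ⟨
        exp s - exp s * i * (exp s - y)  ≈⟨ solve 3 (λ e y i → e :- e :* i :* (e :- y)
                                              := e :* (:1 :+ :- ((e :- y) :* i))) refl (exp s) y i ⟩
        exp s * (1# - d)           ≤⟨ *-monoʳ-≤ (<⇒≤ (exp-pos s)) (1+x≤exp (- d)) ⟩
        exp s * exp (- d)          ≈⟨ exp-+ s (- d) ⟨
        exp (s - d)                ∎)

    lower : y ≤ exp s
    lower = 0≤y-x⇒x≤y (begin
      0#                    ≈⟨ zeroʳ y ⟨
      y * 0#                ≤⟨ *-monoʳ-≤ (<⇒≤ 0<y) (0≤-x (shift-≤ (P≤s (s + d) above)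
                                 (solve 2 (λ s d → :0 :+ (s :+ d) := d :+ s) refl s d))) ⟩
      y * - d               ≈⟨ solve 3 (λ e y i → y :* :- ((y :- e) :* i) := (y :* i) :* (e :- y)) refl (exp s) y i ⟩
      y * i * (exp s - y)   ≈⟨ trans (*-congʳ (⁻¹-inverseʳ _ (pos⇒≉0 0<y))) (*-identityˡ _) ⟩
      exp s - y             ∎)
      where
      i = y ⁻¹
      d = (y - exp s) * i
      above : P (s + d)
      above = *-cancelʳ-≤ (exp-pos (- d)) (begin
        exp (s + d) * exp (- d)   ≈⟨ exp-+ (s + d) (- d) ⟨
        exp ((s + d) - d)         ≈⟨ exp-cong (solve 2 (λ s d → (s :+ d) :- d := s) refl s d) ⟩
        exp s                     ≈⟨ solve 2 (λ e y → e := y :- :1 :* (y :- e)) refl (exp s) y ⟩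
        y - 1# * (y - exp s)      ≈⟨ +-congˡ (-‿cong (*-congʳ (⁻¹-inverseʳ _ (pos⇒≉0 0<y)))) ⟨
        y - y * i * (y - exp s)   ≈⟨ solve 3 (λ e y i → y :- y :* i :* (y :- e)
                                       := y :* (:1 :+ :- ((y :- e) :* i))) refl (exp s) y i ⟩
        y * (1# - d)              ≤⟨ *-monoʳ-≤ (<⇒≤ 0<y) (1+x≤exp (- d)) ⟩
        y * exp (- d)             ∎)

  exp-ln : ∀ {y} → 1# ≤ y → exp (ln y) ≈ y
  exp-ln {y} 1≤y = the-spec {λ x → exp x ≈ y} (exp-surjective 1≤y)

-- Weighted finite sums as expectations.

module Expectation (R : CompleteOrderedField) where

  open OrderedField R

  private variable X : Set

  Mean : (X → ℝ) → List X → (X → ℝ) → ℝ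
  Mean ω xs f = foldr _+_ 0# (map (λ x → ω x * f x) xs)

  Mean-cong : ∀ {ω : X → ℝ} {f g} xs → (∀ x → f x ≈ g x) → Mean ω xs f ≈ Mean ω xs g
  Mean-cong []       eq = refl
  Mean-cong (x ∷ xs) eq = +-cong (*-congˡ (eq x)) (Mean-cong xs eq)

  Mean-mono : ∀ {ω : X → ℝ} {f g} xs → (∀ x → 0# ≤ ω x) → (∀ x → f x ≤ g x) →
    Mean ω xs f ≤ Mean ω xs g
  Mean-mono []       0≤ω le = ≤-refl
  Mean-mono (x ∷ xs) 0≤ω le = +-mono-≤ (*-monoʳ-≤ (0≤ω x) (le x)) (Mean-mono xs 0≤ω le)

  Mean-+ : ∀ {ω : X → ℝ} f g xs → Mean ω xs (λ x → f x + g x) ≈ Mean ω xs f + Mean ω xs g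
  Mean-+ f g []       = sym (+-identityˡ 0#)
  Mean-+ f g (x ∷ xs) = trans (+-cong (distribˡ _ _ _) (Mean-+ f g xs))
    (solve 4 (λ a b c d → (a :+ b) :+ (c :+ d) := (a :+ c) :+ (b :+ d)) refl _ _ _ _)

  Mean-*ˡ : ∀ {ω : X → ℝ} c f xs → Mean ω xs (λ x → c * f x) ≈ c * Mean ω xs f
  Mean-*ˡ c f []       = sym (zeroʳ c)
  Mean-*ˡ c f (x ∷ xs) = trans (+-congˡ (Mean-*ˡ c f xs))
    (solve 4 (λ w c f m → w :* (c :* f) :+ c :* m := c :* (w :* f :+ m)) refl _ c _ _)

  Mean-const : ∀ {ω : X → ℝ} c xs → Mean ω xs (λ _ → c) ≈ c * Mean ω xs (λ _ → 1#)
  Mean-const c xs = trans (Mean-cong xs (λ _ → sym (*-identityʳ c))) (Mean-*ˡ c _ xs)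

  Mean-nonneg : ∀ {ω : X → ℝ} {f} xs → (∀ x → 0# ≤ ω x) → (∀ x → 0# ≤ f x) → 0# ≤ Mean ω xs f
  Mean-nonneg []       0≤ω 0≤f = ≤-refl
  Mean-nonneg (x ∷ xs) 0≤ω 0≤f = +-nonneg (*-nonneg (0≤ω x) (0≤f x)) (Mean-nonneg xs 0≤ω 0≤f)

  Mean-++ : ∀ {ω : X → ℝ} f xs ys → Mean ω (xs ++ ys) f ≈ Mean ω xs f + Mean ω ys f
  Mean-++ f []       ys = sym (+-identityˡ _)
  Mean-++ f (x ∷ xs) ys = trans (+-congˡ (Mean-++ f xs ys)) (sym (+-assoc _ _ _))

  module _ (ω : X → ℝ) where

    Π : ∀ {n} → Vec X n → ℝ
    Π v = product (λ i → ω (lookup v i))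

    Π-nonneg : (∀ x → 0# ≤ ω x) → ∀ {n} (v : Vec X n) → 0# ≤ Π v
    Π-nonneg 0≤ω []      = 0≤1
    Π-nonneg 0≤ω (x ∷ v) = *-nonneg (0≤ω x) (Π-nonneg 0≤ω v)

    Mean-cons : ∀ {n} (f : Vec X (suc n) → ℝ) x vs →
      Mean Π (map (x ∷_) vs) f ≈ ω x * Mean Π vs (λ v → f (x ∷ v))
    Mean-cons f x []       = sym (zeroʳ _)
    Mean-cons f x (v ∷ vs) = trans (+-congˡ (Mean-cons f x vs))
      (solve 4 (λ w p f m → (w :* p) :* f :+ w :* m := w :* (p :* f :+ m)) refl _ _ _ _)

    -- Fubini for the first coordinate: a product-weighted sum over vectors is computed by
    -- conditioning on the head.
    Mean-product : ∀ {n} (f : Vec X (suc n) → ℝ) xs vs →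
      Mean Π (cartesianProductWith _∷_ xs vs) f ≈ Mean ω xs (λ x → Mean Π vs (λ v → f (x ∷ v)))
    Mean-product f []       vs = refl
    Mean-product f (x ∷ xs) vs = trans (Mean-++ f (map (x ∷_) vs) _)
      (+-cong (Mean-cons f x vs) (Mean-product f xs vs))

    Mean-Π-1 : ∀ xs → Mean ω xs (λ _ → 1#) ≈ 1# → ∀ n → Mean Π (allVecs xs n) (λ _ → 1#) ≈ 1#
    Mean-Π-1 xs total zero    = solve 0 (:1 :* :1 :+ :0 := :1) refl
    Mean-Π-1 xs total (suc n) = trans (Mean-product (λ _ → 1#) xs (allVecs xs n))
      (trans (Mean-cong xs (λ _ → Mean-Π-1 xs total n)) total)

-- How many elements of a fixed set a random subset contains.

-- Decides whether S and X share at least k elements. Recursion over the vertices, in place of a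
-- comparison of cardinalities, lets the probability of this event unfold one vertex at a time.
hits : ∀ {a} → ℕ → Subset a → Subset a → Bool
hits zero    S             X            = true
hits (suc k) []            []           = false
hits (suc k) (outside ∷ S) (x ∷ X)      = hits (suc k) S X
hits (suc k) (inside ∷ S)  (inside ∷ X) = hits k S X
hits (suc k) (inside ∷ S)  (outside ∷ X) = hits (suc k) S X

∣S∩∁X∣≤∣S∣ : ∀ {a} (S X : Subset a) → ∣ S ∩ ∁ X ∣ ℕ.≤ ∣ S ∣
∣S∩∁X∣≤∣S∣ S X = ∣p∩q∣≤∣p∣ S (∁ X)

hits-∣∣ : ∀ {a} k (S X : Subset a) → hits k S X ≡ true → k ℕ.+ ∣ S ∩ ∁ X ∣ ℕ.≤ ∣ S ∣
hits-∣∣ zero    S             X             h = ∣S∩∁X∣≤∣S∣ S X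
hits-∣∣ (suc k) []            []            ()
hits-∣∣ (suc k) (outside ∷ S) (x ∷ X)       h = hits-∣∣ (suc k) S X h
hits-∣∣ (suc k) (inside ∷ S)  (inside ∷ X)  h = ℕ.s≤s (hits-∣∣ k S X h)
hits-∣∣ (suc k) (inside ∷ S)  (outside ∷ X) h =
  ≡.subst (ℕ._≤ suc ∣ S ∣) (≡.sym (ℕ.+-suc (suc k) _)) (ℕ.s≤s (hits-∣∣ (suc k) S X h))

module RandomSubset (R : CompleteOrderedField)
    (p : CompleteOrderedField.Carrier R)
    (0≤p : CompleteOrderedField._≤_ R (CompleteOrderedField.0# R) p)
    (p≤1 : CompleteOrderedField._≤_ R p (CompleteOrderedField.1# R)) where

  open OrderedField R
  open Expectation R

  bits : List Bool
  bits = true ∷ false ∷ []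

  ω : Bool → ℝ
  ω x = if x then p else 1# - p

  ω-nonneg : ∀ x → 0# ≤ ω x
  ω-nonneg true  = 0≤p
  ω-nonneg false = x≤y⇒0≤y-x p≤1

  ω-total : Mean ω bits (λ _ → 1#) ≈ 1#
  ω-total = solve 1 (λ p → p :* :1 :+ ((:1 :- p) :* :1 :+ :0) := :1) refl p

  subsets : ∀ a → List (Subset a)
  subsets = allVecs bits

  𝟙 : Bool → ℝ
  𝟙 x = if x then 1# else 0#

  𝟙-nonneg : ∀ x → 0# ≤ 𝟙 x
  𝟙-nonneg true  = 0≤1
  𝟙-nonneg false = ≤-refl

  -- The probability that a binomial variable with parameters |S| and p is at least k.
  μ : ∀ {a} → ℕ → Subset a → ℝ
  μ {a} k S = Mean (Π ω) (subsets a) (λ X → 𝟙 (hits k S X))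

  μ-nonneg : ∀ {a} k (S : Subset a) → 0# ≤ μ k S
  μ-nonneg {a} k S = Mean-nonneg (subsets a) (Π-nonneg ω ω-nonneg) (λ X → 𝟙-nonneg (hits k S X))

  μ-0 : ∀ {a} (S : Subset a) → μ 0 S ≈ 1#
  μ-0 {a} S = Mean-Π-1 ω bits ω-total a

  μ-outside : ∀ {a} k (S : Subset a) → μ (suc k) (outside ∷ S) ≈ μ (suc k) S
  μ-outside {a} k S = trans (Mean-product ω _ bits (subsets a))
    (solve 2 (λ p m → p :* m :+ ((:1 :- p) :* m :+ :0) := m) refl p _)

  μ-inside : ∀ {a} k (S : Subset a) →
    μ (suc k) (inside ∷ S) ≈ p * μ k S + (1# - p) * μ (suc k) S
  μ-inside {a} k S = trans (Mean-product ω _ bits (subsets a)) (+-congˡ (+-identityʳ _))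

  -- Cut S into disjoint groups, one of size i and k of size g, and ask for a hit in every group.
  μ-groups : ∀ {a} g k i (S : Subset a) → i ℕ.≤ g → i ℕ.+ k ℕ.* g ℕ.≤ ∣ S ∣ →
    (1# - (1# - p) ^ i) * (1# - (1# - p) ^ g) ^ k ≤ μ (suc k) S
  μ-groups g k zero    S             i≤g le =
    ≤-trans (≤-reflexive (trans (*-congʳ (-‿inverseʳ 1#)) (zeroˡ _))) (μ-nonneg (suc k) S)
  μ-groups g k (suc i) []            i≤g ()
  μ-groups g k (suc i) (outside ∷ S) i≤g le =
    ≤-respʳ (sym (μ-outside k S)) (μ-groups g k (suc i) S i≤g le)
  μ-groups g k (suc i) (inside ∷ S)  i≤g (ℕ.s≤s le) = begin
    -- Reveal the first vertex of S: with probability p it hits the current group, whose remaining i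
    -- vertices are discarded; otherwise the current group shrinks to i vertices.
    (1# - t * t ^ i) * θ ^ k                    ≈⟨ solve 3 (λ p u v → (:1 :- (:1 :- p) :* u) :* v
                                                     := p :* v :+ (:1 :- p) :* ((:1 :- u) :* v)) refl p (t ^ i) (θ ^ k) ⟩
    p * θ ^ k + t * ((1# - t ^ i) * θ ^ k)      ≤⟨ +-mono-≤ (*-monoʳ-≤ 0≤p (full-groups k (ℕ.≤-trans (ℕ.m≤n+m _ i) le)))
                                                     (*-monoʳ-≤ (x≤y⇒0≤y-x p≤1) (μ-groups g k i S (ℕ.<⇒≤ i≤g) le)) ⟩
    p * μ k S + t * μ (suc k) S                 ≈⟨ μ-inside k S ⟨
    μ (suc k) (inside ∷ S)                      ∎
    where
    open ≤-Reasoning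
    t = 1# - p
    θ = 1# - t ^ g
    full-groups : ∀ k → k ℕ.* g ℕ.≤ ∣ S ∣ → θ ^ k ≤ μ k S
    full-groups zero    le = ≤-reflexive (sym (μ-0 S))
    full-groups (suc k) le = μ-groups g k g S ℕ.≤-refl le

-- The event and its behaviour when one vertex of B is scanned.

-- The event is generalised from A to an arbitrary set S of vertices still to be dominated, so that
-- induction can pass from S to S minus a neighbourhood. `Small` stays abstract because scanning
-- only hands A′ on.
NearlyDominated : ∀ {a b} → (Subset a → Set) → ℕ → Subset a → BipartiteGraph a b → Set
NearlyDominated {a} {b} Small j S G = ∃₂ λ (A′ : Subset a) (D : Subset b) →
  Small A′ × (∀ u → u ∈ S → u ∉ A′ → ∃ λ v → v ∈ D × Adjacent G u v) × ∣ D ∣ ℕ.≤ j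

module _ {a} {Small : Subset a → Set} where

  nearlyDominated-small : ∀ {b j S} (G : BipartiteGraph a b) → Small S → NearlyDominated Small j S G
  nearlyDominated-small {b} {S = S} G small =
    S , ⊥ , small , (λ u u∈S u∉S → contradiction u∈S u∉S) , ≡.subst (ℕ._≤ _) (≡.sym (∣⊥∣≡0 b)) ℕ.z≤n

  nearlyDominated-weaken : ∀ {b j S} (G : BipartiteGraph a b) →
    NearlyDominated Small j S G → NearlyDominated Small (suc j) S G
  nearlyDominated-weaken G (A′ , D , small , dom , ∣D∣≤j) = A′ , D , small , dom , ℕ.m≤n⇒m≤1+n ∣D∣≤j

  nearlyDominated-skip : ∀ {b j S} X (G : BipartiteGraph a b) →
    NearlyDominated Small j S G → NearlyDominated Small j S (X ∷ G)
  nearlyDominated-skip X G (A′ , D , small , dom , ∣D∣≤j) =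
    A′ , outside ∷ D , small ,
    (λ u u∈S u∉A′ → let (v , v∈D , adj) = dom u u∈S u∉A′ in suc v , there v∈D , adj) , ∣D∣≤j

  nearlyDominated-take : ∀ {b j S} X (G : BipartiteGraph a b) →
    NearlyDominated Small j (S ∩ ∁ X) G → NearlyDominated Small (suc j) S (X ∷ G)
  nearlyDominated-take {b} {S = S} X G (A′ , D , small , dom , ∣D∣≤j) =
    A′ , inside ∷ D , small , dom′ , ℕ.s≤s ∣D∣≤j
    where
    dom′ : ∀ u → u ∈ S → u ∉ A′ → ∃ λ v → v ∈ (inside ∷ D) × Adjacent (X ∷ G) u v
    dom′ u u∈S u∉A′ with u ∈? X
    ... | yes u∈X = zero , here , u∈X
    ... | no  u∉X = let (v , v∈D , adj) = dom u (x∈p∩q⁺ (u∈S , x∉p⇒x∈∁p u∉X)) u∉A′ in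
      suc v , there v∈D , adj

-- The scan: probability of too few successes.

module RandomGraph (em : ExcludedMiddle 0ℓ) (R : CompleteOrderedField)
    (p : CompleteOrderedField.Carrier R)
    (0≤p : CompleteOrderedField._≤_ R (CompleteOrderedField.0# R) p)
    (p≤1 : CompleteOrderedField._≤_ R p (CompleteOrderedField.1# R)) where

  open OrderedField R
  open Expectation R
  open RandomSubset R p 0≤p p≤1
  open Reals em R using (ℙ)

  ⟦_⟧ : Set → ℝ
  ⟦ P ⟧ = 𝟙 (does (em {P}))

  ⟦⟧-true : ∀ {P} → P → ⟦ P ⟧ ≈ 1#
  ⟦⟧-true {P} x with em {P}
  ... | yes _ = refl
  ... | no ¬x = contradiction x ¬x

  ⟦⟧-mono : ∀ {P Q} → (P → Q) → ⟦ P ⟧ ≤ ⟦ Q ⟧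
  ⟦⟧-mono {P} {Q} P⇒Q with em {P}
  ... | no _  = 𝟙-nonneg _
  ... | yes x = ≤-reflexive (sym (⟦⟧-true (P⇒Q x)))

  weight : ∀ {a} → Subset a → ℝ
  weight = Π ω

  weight-nonneg : ∀ {a} (X : Subset a) → 0# ≤ weight X
  weight-nonneg = Π-nonneg ω ω-nonneg

  graphWeight-nonneg : ∀ {a b} (G : BipartiteGraph a b) → 0# ≤ Π weight G
  graphWeight-nonneg = Π-nonneg weight weight-nonneg

  ℙ-Mean : ∀ {a b} (Ev : BipartiteGraph a b → Set) →
    ℙ a b p Ev ≈ Mean (Π weight) (allBipartiteGraphs a b) (λ G → ⟦ Ev G ⟧)
  ℙ-Mean {a} {b} Ev = go (allBipartiteGraphs a b)
    where
    step : ∀ w d → (if d then w else 0#) ≈ w * 𝟙 d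
    step w true  = sym (*-identityʳ w)
    step w false = sym (zeroʳ w)
    go : ∀ Gs → foldr _+_ 0# (map (λ G → if does (em {Ev G}) then Π weight G else 0#) Gs)
                ≈ Mean (Π weight) Gs (λ G → ⟦ Ev G ⟧)
    go []       = refl
    go (G ∷ Gs) = +-cong (step (Π weight G) (does (em {Ev G}))) (go Gs)

  ℙ-mono : ∀ a b {Ev Ev′ : BipartiteGraph a b → Set} → (∀ G → Ev G → Ev′ G) →
    ℙ a b p Ev ≤ ℙ a b p Ev′
  ℙ-mono a b {Ev} {Ev′} Ev⇒Ev′ = ≤-respˡ (sym (ℙ-Mean Ev)) (≤-respʳ (sym (ℙ-Mean Ev′))
    (Mean-mono (allBipartiteGraphs a b) graphWeight-nonneg (λ G → ⟦⟧-mono (Ev⇒Ev′ G))))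

  ℙ-nonneg : ∀ a b (Ev : BipartiteGraph a b → Set) → 0# ≤ ℙ a b p Ev
  ℙ-nonneg a b Ev = ≤-respʳ (sym (ℙ-Mean Ev))
    (Mean-nonneg (allBipartiteGraphs a b) graphWeight-nonneg (λ G → 𝟙-nonneg (does (em {Ev G}))))

  ℙ-certain : ∀ a b {Ev : BipartiteGraph a b → Set} → (∀ G → Ev G) → ℙ a b p Ev ≈ 1#
  ℙ-certain a b {Ev} certain = trans (ℙ-Mean Ev)
    (trans (Mean-cong (allBipartiteGraphs a b) (λ G → ⟦⟧-true (certain G)))
      (Mean-Π-1 weight (subsets a) (Mean-Π-1 ω bits ω-total a) b))

  ℙ-cons : ∀ a b (Ev : BipartiteGraph a (suc b) → Set) →
    ℙ a (suc b) p Ev ≈ Mean weight (subsets a) (λ X → ℙ a b p (λ G → Ev (X ∷ G)))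
  ℙ-cons a b Ev = trans (ℙ-Mean Ev)
    (trans (Mean-product weight (λ G → ⟦ Ev G ⟧) (subsets a) (allBipartiteGraphs a b))
      (Mean-cong (subsets a) (λ X → sym (ℙ-Mean (λ G → Ev (X ∷ G))))))

  -- A set of undominated vertices has level j when its size is at most τ j. The
  -- equation for r says that r = 1 - q/2.
  module Scan {a} (τ : ℕ → ℝ) (J : ℕ) (q r : ℝ)
      (q+2r≈2 : q + (r + r) ≈ 1# + 1#) (0≤r : 0# ≤ r)
      (success : ∀ j (S : Subset a) → j ℕ.< J → τ j ≤ fromℕ ∣ S ∣ → fromℕ ∣ S ∣ ≤ τ (suc j) →
        ∃ λ k → q ≤ μ k S × (∀ s → k ℕ.+ s ℕ.≤ ∣ S ∣ → fromℕ s ≤ τ j))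
    where

    Event : ∀ {b} → ℕ → Subset a → BipartiteGraph a b → Set
    Event = NearlyDominated (λ A′ → fromℕ ∣ A′ ∣ ≤ τ 0)

    2^ : ℕ → ℝ
    2^ j = (1# + 1#) ^ j

    0≤2^*r^ : ∀ j b → 0# ≤ 2^ j * r ^ b
    0≤2^*r^ j b = *-nonneg (^-nonneg j (+-nonneg 0≤1 0≤1)) (^-nonneg b 0≤r)

    1-x≤1 : ∀ {x} → 0# ≤ x → 1# - x ≤ 1#
    1-x≤1 {x} 0≤x = shift-≤ 0≤x (solve 1 (λ x → :1 :+ :0 := (:1 :- x) :+ x) refl x)

    -- The bound f(j, b) = 2^j r^b on failure solves the recursion f(j+1, b+1) = q f(j, b) + (1 - q)
    -- f(j+1, b) exactly, because q/2 + (1 - q) = r. At b = 0 it is at least 1 and claims nothing;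
    -- at j = 0 failure is impossible.
    ℙ-Event : ∀ b j (S : Subset a) → j ℕ.≤ J → fromℕ ∣ S ∣ ≤ τ j →
      1# - 2^ j * r ^ b ≤ ℙ a b p (Event j S)
    ℙ-Event b zero S j≤J small = ≤-trans (1-x≤1 (0≤2^*r^ 0 b))
      (≤-reflexive (sym (ℙ-certain a b (λ G → nearlyDominated-small G small))))
    ℙ-Event zero (suc j) S j≤J small = ≤-trans
      (shift-≤ (1≤^ (suc j) (x≤x+y 0≤1))
        (solve 1 (λ x → :0 :+ :1 := (:1 :- x :* :1) :+ x) refl (2^ (suc j))))
      (ℙ-nonneg a 0 (Event (suc j) S))
    ℙ-Event (suc b) (suc j) S j<J small with total (fromℕ ∣ S ∣) (τ j)
    ... | inj₁ smaller = begin
      1# - 2^ (suc j) * r ^ suc b     ≤⟨ shift-≤ (0≤2^*r^ j (suc b))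
                                           (solve 2 (λ t u → (:1 :- t :* u) :+ :0
                                             := (:1 :- (:1 :+ :1) :* t :* u) :+ t :* u) refl (2^ j) (r ^ suc b)) ⟩
      1# - 2^ j * r ^ suc b           ≤⟨ ℙ-Event (suc b) j S (ℕ.<⇒≤ j<J) smaller ⟩
      ℙ a (suc b) p (Event j S)       ≤⟨ ℙ-mono a (suc b) nearlyDominated-weaken ⟩
      ℙ a (suc b) p (Event (suc j) S) ∎
      where open ≤-Reasoning
    ... | inj₂ τj≤S = begin
      1# - 2^ (suc j) * r ^ suc b                       ≈⟨ solve 3 (λ t r u → :1 :- (:1 :+ :1) :* t :* (r :* u)
                                                             := (:1 :- (:1 :+ :1) :* t :* u) :+ t :* u :* ((:1 :+ :1) :- (r :+ r)))
                                                             refl (2^ j) r (r ^ b) ⟩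
      B + Z * ((1# + 1#) - (r + r))                     ≈⟨ +-congˡ (*-congˡ (+-congʳ q+2r≈2)) ⟨
      B + Z * ((q + (r + r)) - (r + r))                 ≈⟨ solve 4 (λ B Z q r → B :+ Z :* ((q :+ r) :- r) := B :+ Z :* q)
                                                             refl B Z q (r + r) ⟩
      B + Z * q                                         ≤⟨ +-monoʳ-≤ B (*-monoʳ-≤ (0≤2^*r^ j b) q≤μ) ⟩
      B + Z * μ k S                                     ≈⟨ +-cong (trans (*-congˡ (Mean-Π-1 ω bits ω-total a)) (*-identityʳ B))
                                                             (Mean-*ˡ {ω = weight} Z (λ X → 𝟙 (hits k S X)) (subsets a)) ⟨
      B * Mean weight (subsets a) (λ _ → 1#) + Mean weight (subsets a) (λ X → Z * 𝟙 (hits k S X))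
                                                        ≈⟨ +-congʳ (Mean-const {ω = weight} B (subsets a)) ⟨
      Mean weight (subsets a) (λ _ → B) + Mean weight (subsets a) (λ X → Z * 𝟙 (hits k S X))
                                                        ≈⟨ Mean-+ {ω = weight} (λ _ → B) (λ X → Z * 𝟙 (hits k S X)) (subsets a) ⟨
      Mean weight (subsets a) (λ X → B + Z * 𝟙 (hits k S X))
                                                        ≤⟨ Mean-mono (subsets a) weight-nonneg first ⟩
      Mean weight (subsets a) (λ X → ℙ a b p (λ G → Event (suc j) S (X ∷ G)))
                                                        ≈⟨ ℙ-cons a b (Event (suc j) S) ⟨
      ℙ a (suc b) p (Event (suc j) S)                   ∎
      where
      open ≤-Reasoning
      -- `B` is the bound available after a miss and `Z` the gain from a success, 2^(j+1) r^b - 2^j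
      -- r^b. As the gain is nonnegative, a lower bound on the success probability is enough.
      B = 1# - 2^ (suc j) * r ^ b
      Z = 2^ j * r ^ b
      k = proj₁ (success j S j<J τj≤S small)
      q≤μ = proj₁ (proj₂ (success j S j<J τj≤S small))
      drop = proj₂ (proj₂ (success j S j<J τj≤S small))
      first : ∀ X → B + Z * 𝟙 (hits k S X) ≤ ℙ a b p (λ G → Event (suc j) S (X ∷ G))
      first X with hits k S X in eq
      ... | true  = begin
        B + Z * 1#                                   ≈⟨ solve 2 (λ t u → (:1 :- (:1 :+ :1) :* t :* u) :+ t :* u :* :1
                                                          := :1 :- t :* u) refl (2^ j) (r ^ b) ⟩
        1# - Z                                       ≤⟨ ℙ-Event b j (S ∩ ∁ X) (ℕ.<⇒≤ j<J) (drop _ (hits-∣∣ k S X eq)) ⟩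
        ℙ a b p (Event j (S ∩ ∁ X))                  ≤⟨ ℙ-mono a b (nearlyDominated-take X) ⟩
        ℙ a b p (λ G → Event (suc j) S (X ∷ G))      ∎
      ... | false = begin
        B + Z * 0#                                   ≈⟨ trans (+-congˡ (zeroʳ Z)) (+-identityʳ B) ⟩
        B                                            ≤⟨ ℙ-Event b (suc j) S j<J small ⟩
        ℙ a b p (Event (suc j) S)                    ≤⟨ ℙ-mono a b (nearlyDominated-skip X) ⟩
        ℙ a b p (λ G → Event (suc j) S (X ∷ G))      ∎

-- Lower bounds on the probability that one vertex succeeds.

module Greedy (em : ExcludedMiddle 0ℓ) (R : CompleteOrderedField)
    (p : CompleteOrderedField.Carrier R)
    (0≤p : CompleteOrderedField._≤_ R (CompleteOrderedField.0# R) p)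
    (p≤1 : CompleteOrderedField._≤_ R p (CompleteOrderedField.1# R)) where

  open OrderedField R
  open Archimedean em R
  open Exponential em R
  open RandomSubset R p 0≤p p≤1
  open Reals em R using (exp)

  -- Bernoulli's inequality in reciprocal form; the step is (1 - p)(1 + p (g + 1)) ≤ 1 + p g.
  bernoulli : ∀ g → (1# - p) ^ g * (1# + p * fromℕ g) ≤ 1#
  bernoulli zero    = ≤-reflexive (solve 1 (λ p → :1 :* (:1 :+ p :* :0) := :1) refl p)
  bernoulli (suc g) = ≤-trans
    (shift-≤ (*-nonneg (^-nonneg g (x≤y⇒0≤y-x p≤1)) (*-nonneg (square-nonneg p) (fromℕ-nonneg (suc g))))
      (solve 3 (λ p u g → u :* (:1 :+ p :* g) :+ :0
        := (:1 :- p) :* u :* (:1 :+ p :* (:1 :+ g)) :+ u :* (p :* p :* (:1 :+ g))) refl p _ (fromℕ g)))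
    (bernoulli g)

  -- With x = p g, a miss has probability at most 1 / (1 + x), and x / (1 + x) ≥ 1 / (1 + y) as soon
  -- as x y ≥ 1. Small and large x need no separate treatment.
  group-hit : ∀ g {y} → 0# ≤ y → 1# ≤ p * fromℕ g * y → 1# ≤ (1# - (1# - p) ^ g) * (1# + y)
  group-hit g {y} 0≤y 1≤pgy = shift-≤
    (*-cancelʳ-≤ {1# + x} (+-pos 0<1 0≤x) (begin
      t * (1# + y) * (1# + x)     ≈⟨ solve 3 (λ t x y → t :* (:1 :+ y) :* (:1 :+ x) := t :* (:1 :+ x) :* (:1 :+ y)) refl t x y ⟩
      t * (1# + x) * (1# + y)     ≤⟨ *-monoˡ-≤ (+-nonneg 0≤1 0≤y) (bernoulli g) ⟩
      1# * (1# + y)               ≤⟨ shift-≤ 1≤pgy (solve 2 (λ x y → y :* (:1 :+ x) :+ :1 := :1 :* (:1 :+ y) :+ x :* y) refl x y) ⟩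
      y * (1# + x)                ∎))
    (solve 2 (λ t y → (:1 :- t) :* (:1 :+ y) :+ t :* (:1 :+ y) := :1 :+ y) refl t y)
    where
    open ≤-Reasoning
    t = (1# - p) ^ g
    x = p * fromℕ g
    0≤x = *-nonneg 0≤p (fromℕ-nonneg g)

  μ-lower : ∀ {a} k g {y q} (S : Subset a) → suc k ℕ.* g ℕ.≤ ∣ S ∣ →
    0# ≤ y → 1# ≤ p * fromℕ g * y → (1# + y) ^ suc k * q ≤ 1# → q ≤ μ (suc k) S
  μ-lower k g {y} {q} S kg≤S 0≤y 1≤pgy small = ≤-trans
    (*-cancelˡ-≤ {v} 0<v (begin
      v * q                         ≤⟨ small ⟩
      1#                            ≤⟨ 1≤^ (suc k) (group-hit g 0≤y 1≤pgy) ⟩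
      (θ * (1# + y)) ^ suc k        ≈⟨ Algebra.Properties.CommutativeSemiring.Exp.^-distrib-*
                                         (CommutativeRing.commutativeSemiring commutativeRing) θ (1# + y) (suc k) ⟩
      θ ^ suc k * v                 ≈⟨ *-comm _ v ⟩
      v * θ ^ suc k                 ∎))
    (μ-groups g k g S ℕ.≤-refl kg≤S)
    where
    open ≤-Reasoning
    θ = 1# - (1# - p) ^ g
    v = (1# + y) ^ suc k
    0<v : 0# < v
    0<v = <-≤-trans 0<1 (1≤^ (suc k) (x≤x+y 0≤y))


  -- Here η plays ln h and D plays δ ln n. The first numerical hypothesis pushes the levels that ask
  -- for several neighbours far up, the second pays for the factor exp (k z), and the third for h^k.
  module Levels (h η D σ : ℝ) (0<p : 0# < p) (1≤h : 1# ≤ h) (exp-η : exp η ≈ h)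
      (h≤expD : h ≤ exp D) (0≤σ : 0# ≤ σ) (0≤η : 0# ≤ η) (J : ℕ)
      (32σ≤1 : lit 32 * σ ≤ 1#) (256σ≤Dρ : lit 256 * σ ≤ D * (p * h))
      (8σJη≤D : lit 8 * (σ * fromℕ J * η) ≤ D) where

    -- The factor `1#` makes `M` literally the `1# / (p * h)` of the statement. The ½ in `q` absorbs
    -- the loss in 1 + h ≤ 2 h when a single neighbour is required.
    ρ M q : ℝ
    ρ = p * h
    M = 1# * ρ ⁻¹
    q = ½ * exp (- D)

    τ : ℕ → ℝ
    τ j = M + σ * (fromℕ j * fromℕ j)

    0<h : 0# < h
    0<h = <-≤-trans 0<1 1≤h

    0<ρ : 0# < ρ
    0<ρ = *-pos 0<p 0<h

    0≤M : 0# ≤ M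
    0≤M = *-nonneg 0≤1 (⁻¹-nonneg 0<ρ)

    0≤q : 0# ≤ q
    0≤q = <⇒≤ (*-pos 0<½ (exp-pos (- D)))

    2x*q≤1 : ∀ {x} → x ≤ exp D → (1# + 1#) * x * q ≤ 1#
    2x*q≤1 {x} x≤ = begin
      (1# + 1#) * x * (½ * exp (- D))                    ≈⟨ solve 3 (λ x h e → (:1 :+ :1) :* x :* (h :* e)
                                                              := x :* (h :* e :+ h :* e)) refl x ½ (exp (- D)) ⟩
      x * (½ * exp (- D) + ½ * exp (- D))                ≈⟨ *-congˡ (½+½ _) ⟩
      x * exp (- D)                                      ≤⟨ *-monoˡ-≤ (<⇒≤ (exp-pos _)) x≤ ⟩
      exp D * exp (- D)                                  ≈⟨ exp*exp-neg D ⟩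
      1#                                                 ∎
      where open ≤-Reasoning

    success-one : ∀ {a} (S : Subset a) → M ≤ fromℕ ∣ S ∣ → q ≤ μ 1 S
    success-one S M≤S = μ-lower 0 s S (ℕ.≤-reflexive (ℕ.*-identityˡ s)) (<⇒≤ 0<h)
      (begin
        1#                   ≈⟨ trans (*-congʳ (*-identityˡ _)) (⁻¹-inverseˡ 0<ρ) ⟨
        M * ρ                ≤⟨ *-monoˡ-≤ (<⇒≤ 0<ρ) M≤S ⟩
        fromℕ s * (p * h)    ≈⟨ solve 3 (λ s p h → s :* (p :* h) := p :* s :* h) refl _ p h ⟩
        p * fromℕ s * h      ∎)
      (begin
        (1# + h) * 1# * q    ≤⟨ *-monoˡ-≤ 0≤q (shift-≤ 1≤h (solve 1 (λ h → (:1 :+ :1) :* h :+ :1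
                                  := (:1 :+ h) :* :1 :+ h) refl h)) ⟩
        (1# + 1#) * h * q    ≤⟨ 2x*q≤1 h≤expD ⟩
        1#                   ∎)
      where
      open ≤-Reasoning
      s = ∣ S ∣

    -- With k = κ + 2 groups and y = h z, each factor obeys 1 + h z ≤ h (1 + z) ≤ exp (η + z), so
    -- the cost splits into k η and k z; each is at most D/2.
    success-many : ∀ {a} j κ (S : Subset a) → j ℕ.< J → τ j ≤ fromℕ ∣ S ∣ →
      fromℕ (suc κ) ≤ (1# + 1#) * (σ * fromℕ (suc j)) → q ≤ μ (suc (suc κ)) S
    success-many j κ S j<J τj≤S κ≤ = μ-lower (suc κ) g S kg≤s 0≤y
      (≤-trans (*-cancelʳ-≤ 0<σI² (begin
        1# * σI²                        ≈⟨ *-identityˡ σI² ⟩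
        σI²                             ≤⟨ σI²≤4s ⟩
        lit 4 * fromℕ s                 ≤⟨ *-monoʳ-≤ (lit-nonneg 4) s≤2kg ⟩
        lit 4 * (lit 2 * (K * G))       ≈⟨ solve 2 (λ k g → :lit 4 :* (:lit 2 :* (k :* g)) := g :* (:lit 8 :* k)) refl K G ⟩
        G * (lit 8 * K)                 ≈⟨ *-congˡ z-eq ⟨
        G * (z * (ρ * σI²))             ≈⟨ solve 5 (λ g z p h s → g :* (z :* (p :* h :* s)) := p :* g :* (h :* z) :* s) refl G z p h σI² ⟩
        p * G * (h * z) * σI²           ∎)) ≤-refl)
      (begin
        (1# + h * z) ^ k * q            ≤⟨ *-monoˡ-≤ 0≤q (^-mono-≤ k (+-nonneg 0≤1 0≤y) base) ⟩
        exp (η + z) ^ k * q             ≈⟨ *-congʳ (exp-^ (η + z) k) ⟩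
        exp (K * (η + z)) * q           ≤⟨ *-monoˡ-≤ 0≤q (exp-mono-≤ exponent) ⟩
        exp D * q                       ≤⟨ *-monoˡ-≤ 0≤q (shift-≤ (<⇒≤ (exp-pos D)) (solve 1 (λ e → (:1 :+ :1) :* e :+ :0 := e :+ e) refl (exp D))) ⟩
        (1# + 1#) * exp D * q           ≤⟨ 2x*q≤1 ≤-refl ⟩
        1#                              ∎)
      where
      open ≤-Reasoning
      s = ∣ S ∣
      k = suc (suc κ)
      g = s ℕ./ k
      K = fromℕ k
      G = fromℕ g
      I = fromℕ (suc j)
      σI = σ * I
      σI² = σ * (I * I)

      1≤2σI : 1# ≤ (1# + 1#) * σI
      1≤2σI = ≤-trans (1≤fromℕ {suc κ} (ℕ.s≤s ℕ.z≤n)) κ≤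

      K≤4σI : K ≤ lit 4 * σI
      K≤4σI = shift-≤ (+-mono-≤ 1≤2σI κ≤)
        (solve 2 (λ k σI → :lit 4 :* σI :+ (:1 :+ k) := (:1 :+ k) :+ ((:1 :+ :1) :* σI :+ (:1 :+ :1) :* σI)) refl (fromℕ (suc κ)) σI)

      -- Several neighbours are asked for only when 2 σ I ≥ 1, and σ ≤ 1/32 then makes I large.
      -- Hence consecutive levels are comparable, I² ≤ 4 (I - 1)², and S has room for k nonempty
      -- groups.
      16≤I : lit 16 ≤ I
      16≤I = begin
        lit 16                          ≈⟨ *-identityʳ _ ⟨
        lit 16 * 1#                     ≤⟨ *-monoʳ-≤ (lit-nonneg 16) 1≤2σI ⟩
        lit 16 * ((1# + 1#) * (σ * I))  ≈⟨ solve 2 (λ σ I → :lit 16 :* ((:1 :+ :1) :* (σ :* I)) := :lit 32 :* σ :* I) refl σ I ⟩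
        lit 32 * σ * I                  ≤⟨ *-monoˡ-≤ (fromℕ-nonneg (suc j)) 32σ≤1 ⟩
        1# * I                          ≈⟨ *-identityˡ I ⟩
        I                               ∎

      0<σI : 0# < σI
      0<σI = *-nonneg 0≤σ (fromℕ-nonneg (suc j)) , λ eq →
        0≉1 (antisym 0≤1 (≤-respʳ (trans (*-congˡ (sym eq)) (zeroʳ _)) 1≤2σI))

      0<I : 0# < I
      0<I = fromℕ-pos j

      0<σI² : 0# < σI²
      0<σI² = ≤-respʳ (*-assoc σ I I) (<⇒≤ (*-pos 0<σI 0<I)) , λ eq →
        <⇒≉ (*-pos 0<σI 0<I) (trans eq (sym (*-assoc σ I I)))

      -- 4 (I - 1)² - I² = (3 I - 2) (I - 2)
      σI²≤4s : σI² ≤ lit 4 * fromℕ s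
      σI²≤4s = begin
        σ * (I * I)                       ≤⟨ *-monoʳ-≤ 0≤σ (shift-≤ (*-nonneg 0≤3I-2 0≤I-2)
                                               (solve 1 (λ i → :lit 4 :* (i :* i) :+ :0
                                                 := (:1 :+ i) :* (:1 :+ i) :+ (:lit 3 :* (:1 :+ i) :- :lit 2) :* ((:1 :+ i) :- :lit 2)) refl i)) ⟩
        σ * (lit 4 * (i * i))             ≈⟨ solve 2 (λ σ i → σ :* (:lit 4 :* (i :* i)) := :lit 4 :* (σ :* (i :* i))) refl σ i ⟩
        lit 4 * (σ * (i * i))             ≤⟨ *-monoʳ-≤ (lit-nonneg 4) (≤-trans (x≤y+x 0≤M) τj≤S) ⟩
        lit 4 * fromℕ s                   ∎
        where
        i = fromℕ j
        0≤I-2 : 0# ≤ I - lit 2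
        0≤I-2 = shift-≤ (+-mono-≤ 16≤I (lit-nonneg 14))
          (solve 1 (λ I → (I :- :lit 2) :+ (:lit 16 :+ :0) := :0 :+ (I :+ :lit 14)) refl I)
        0≤3I-2 : 0# ≤ lit 3 * I - lit 2
        0≤3I-2 = shift-≤ (+-mono-≤ 0≤I-2 (*-nonneg (lit-nonneg 2) (<⇒≤ 0<I)))
          (solve 1 (λ I → (:lit 3 :* I :- :lit 2) :+ (:0 :+ :0) := :0 :+ ((I :- :lit 2) :+ :lit 2 :* I)) refl I)

      K≤s : K ≤ fromℕ s
      K≤s = *-cancelˡ-≤ {lit 4} 0<4 (begin
        lit 4 * K              ≤⟨ *-monoʳ-≤ (lit-nonneg 4) K≤4σI ⟩
        lit 4 * (lit 4 * σI)   ≈⟨ solve 1 (λ x → :lit 4 :* (:lit 4 :* x) := x :* :lit 16) refl σI ⟩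
        σI * lit 16            ≤⟨ *-monoʳ-≤ (<⇒≤ 0<σI) 16≤I ⟩
        σI * I                 ≈⟨ *-assoc σ I I ⟩
        σI²                    ≤⟨ σI²≤4s ⟩
        lit 4 * fromℕ s        ∎)
        where
        0<4 : 0# < lit 4
        0<4 = <-≤-trans 0<1 (≤-respˡ (+-identityˡ 1#) (+-monoˡ-≤ 1# (lit-nonneg 3)))

      k≤s : k ℕ.≤ s
      k≤s with k ℕ.≤? s
      ... | yes le = le
      ... | no  nle = contradiction (≤-trans (fromℕ-mono (ℕ.≰⇒> nle)) K≤s)
        λ le → 0≉1 (antisym 0≤1 (+-cancelʳ-≤ (fromℕ s) (≤-respʳ (sym (+-identityˡ _)) le)))

      kg≤s : k ℕ.* g ℕ.≤ s
      kg≤s = ≡.subst (ℕ._≤ s) (ℕ.*-comm g k) (ℕ.m/n*n≤m s k)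

      s≤2kg : fromℕ s ≤ lit 2 * (K * G)
      s≤2kg = begin
        fromℕ s                       ≡⟨ ≡.cong fromℕ (ℕ.m≡m%n+[m/n]*n s k) ⟩
        -- The remainder is below k, and k ≤ g k because k ≤ s makes the groups nonempty; rounding
        -- the group size thus loses at most a factor 2.
        fromℕ (s ℕ.% k ℕ.+ g ℕ.* k)   ≤⟨ fromℕ-mono (ℕ.+-monoˡ-≤ (g ℕ.* k) (ℕ.≤-trans (ℕ.<⇒≤ (ℕ.m%n<n s k))
                                           (ℕ.m≤n*m k g ⦃ ℕ.>-nonZero (ℕ.m≥n⇒m/n>0 k≤s) ⦄))) ⟩
        fromℕ (g ℕ.* k ℕ.+ g ℕ.* k)   ≈⟨ trans (fromℕ-+ (g ℕ.* k) _) (+-cong (fromℕ-* g k) (fromℕ-* g k)) ⟩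
        G * K + G * K                 ≈⟨ solve 2 (λ g k → g :* k :+ g :* k := :lit 2 :* (k :* g)) refl G K ⟩
        lit 2 * (K * G)               ∎

      z y : ℝ
      -- The 8 collects the factor 2 lost in s ≤ 2 k g and the 4 lost in σ I² ≤ 4 s; it makes p g y
      -- ≥ 1.
      z = lit 8 * K * (ρ * σI²) ⁻¹
      y = h * z

      0≤z : 0# ≤ z
      0≤z = *-nonneg (*-nonneg (lit-nonneg 8) (fromℕ-nonneg k)) (⁻¹-nonneg (*-pos 0<ρ 0<σI²))

      0≤y : 0# ≤ y
      0≤y = *-nonneg (<⇒≤ 0<h) 0≤z

      z-eq : z * (ρ * σI²) ≈ lit 8 * K
      z-eq = trans (*-assoc _ _ _) (trans (*-congˡ (⁻¹-inverseˡ (*-pos 0<ρ 0<σI²))) (*-identityʳ _))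

      base : 1# + h * z ≤ exp (η + z)
      base = begin
        1# + h * z           ≤⟨ +-monoˡ-≤ (h * z) 1≤h ⟩
        h + h * z            ≈⟨ solve 2 (λ h z → h :+ h :* z := h :* (:1 :+ z)) refl h z ⟩
        h * (1# + z)         ≤⟨ *-monoʳ-≤ (<⇒≤ 0<h) (1+x≤exp z) ⟩
        h * exp z            ≈⟨ *-congʳ exp-η ⟨
        exp η * exp z        ≈⟨ exp-+ η z ⟨
        exp (η + z)          ∎

      2Kη≤D : lit 2 * (K * η) ≤ D
      2Kη≤D = begin
        lit 2 * (K * η)                ≤⟨ *-monoʳ-≤ (lit-nonneg 2) (*-monoˡ-≤ 0≤η K≤4σI) ⟩
        lit 2 * (lit 4 * (σ * I) * η)  ≈⟨ solve 3 (λ σ I η → :lit 2 :* (:lit 4 :* (σ :* I) :* η) := :lit 8 :* (σ :* I :* η)) refl σ I η ⟩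
        lit 8 * (σ * I * η)            ≤⟨ *-monoʳ-≤ (lit-nonneg 8) (*-monoˡ-≤ 0≤η (*-monoʳ-≤ 0≤σ (fromℕ-mono j<J))) ⟩
        lit 8 * (σ * fromℕ J * η)      ≤⟨ 8σJη≤D ⟩
        D                              ∎

      -- Since K ≤ 4 σ I is linear in I while z carries 1/I², the level cancels from K z and 256 σ /
      -- ρ ≤ D remains.
      2Kz≤D : lit 2 * (K * z) ≤ D
      2Kz≤D = *-cancelʳ-≤ (*-pos 0<ρ 0<σI²) (begin
        lit 2 * (K * z) * (ρ * σI²)              ≈⟨ solve 3 (λ k z r → :lit 2 :* (k :* z) :* r := :lit 2 :* k :* (z :* r)) refl K z _ ⟩
        lit 2 * K * (z * (ρ * σI²))              ≈⟨ *-congˡ z-eq ⟩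
        lit 2 * K * (lit 8 * K)                  ≈⟨ solve 1 (λ k → :lit 2 :* k :* (:lit 8 :* k) := :lit 16 :* (k :* k)) refl K ⟩
        lit 16 * (K * K)                         ≤⟨ *-monoʳ-≤ (lit-nonneg 16) (*-mono-≤ (fromℕ-nonneg k) (fromℕ-nonneg k) K≤4σI K≤4σI) ⟩
        lit 16 * (lit 4 * (σ * I) * (lit 4 * (σ * I)))  ≈⟨ solve 2 (λ σ I → :lit 16 :* (:lit 4 :* (σ :* I) :* (:lit 4 :* (σ :* I)))
                                                      := :lit 256 :* σ :* (σ :* (I :* I))) refl σ I ⟩
        lit 256 * σ * σI²                        ≤⟨ *-monoˡ-≤ (<⇒≤ 0<σI²) 256σ≤Dρ ⟩
        D * ρ * σI²                              ≈⟨ *-assoc D ρ σI² ⟩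
        D * (ρ * σI²)                            ∎)

      exponent : K * (η + z) ≤ D
      exponent = 0≤y-x⇒x≤y (x+x≥0⇒x≥0 (≤-trans (x≤y⇒0≤y-x (+-mono-≤ 2Kη≤D 2Kz≤D)) (≤-reflexive
        (solve 4 (λ k η z D → (D :+ D) :- (:lit 2 :* (k :* η) :+ :lit 2 :* (k :* z))
          := (D :- k :* (η :+ z)) :+ (D :- k :* (η :+ z))) refl K η z D))))

    success : ∀ {a} j (S : Subset a) → j ℕ.< J → τ j ≤ fromℕ ∣ S ∣ → fromℕ ∣ S ∣ ≤ τ (suc j) →
      ∃ λ k → q ≤ μ k S × (∀ s → k ℕ.+ s ℕ.≤ ∣ S ∣ → fromℕ s ≤ τ j)
    success j S j<J τj≤S S≤τ = suc κ , enough κ (proj₁ (proj₂ κ-floor)) , drop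
      where
      open ≤-Reasoning
      κ-floor = floor ((1# + 1#) * (σ * fromℕ (suc j)))
        (*-nonneg (+-nonneg 0≤1 0≤1) (*-nonneg 0≤σ (fromℕ-nonneg (suc j))))
      κ = proj₁ κ-floor
      enough : ∀ κ → fromℕ κ ≤ (1# + 1#) * (σ * fromℕ (suc j)) → q ≤ μ (suc κ) S
      enough zero    κ≤ = success-one S (≤-trans (x≤x+y (*-nonneg 0≤σ (square-nonneg (fromℕ j)))) τj≤S)
      enough (suc κ) κ≤ = success-many j κ S j<J τj≤S κ≤
      drop : ∀ s → suc κ ℕ.+ s ℕ.≤ ∣ S ∣ → fromℕ s ≤ τ j
      -- The gap between the levels is σ (2 j + 1) = 2 σ (j + 1) - σ, which is at most κ + 1.
      drop s le = shift-≤ (+-mono-≤ (≤-trans (≤-trans (≤-reflexive (sym (fromℕ-+ (suc κ) s))) (fromℕ-mono le)) S≤τ)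
                                    (+-mono-≤ (proj₂ (proj₂ κ-floor)) 0≤σ))
        (solve 5 (λ M σ j k s →
          (M :+ σ :* (j :* j)) :+ ((k :+ s) :+ ((:1 :+ :1) :* (σ :* (:1 :+ j)) :+ :0))
          := s :+ ((M :+ σ :* ((:1 :+ j) :* (:1 :+ j))) :+ (k :+ σ)))
          refl M σ (fromℕ j) (fromℕ (suc κ)) (fromℕ s))

-- Choice of the constants and conclusion.

module Bound (em : ExcludedMiddle 0ℓ) (R : CompleteOrderedField)
    (α δ : CompleteOrderedField.Carrier R)
    (0<α : CompleteOrderedField._<_ R (CompleteOrderedField.0# R) α)
    (0<δ : CompleteOrderedField._<_ R (CompleteOrderedField.0# R) δ) where

  open OrderedField R
  open Archimedean em R
  open Exponential em R
  open Reals em R using (exp; ln; e; ℙ; _^ʳ_; _/_)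

  -- The summand α makes σ small and J at least 1; α / δ compares the bound α ln n on a ρ with the
  -- budget δ ln n; the 1 keeps C above fixed numbers. The 128 is 32 times the 4 in `σC²≤4αlρ`, as
  -- needed for 32 σ ≤ 1.
  C : ℝ
  C = lit 128 * (1# + α + α * δ ⁻¹)

  0≤α/δ : 0# ≤ α * δ ⁻¹
  0≤α/δ = <⇒≤ (*-pos 0<α (⁻¹-pos 0<δ))

  0≤1+α : 0# ≤ 1# + α
  0≤1+α = +-nonneg 0≤1 (<⇒≤ 0<α)

  128≤C : lit 128 ≤ C
  128≤C = ≤-respˡ (*-identityʳ _) (*-monoʳ-≤ (lit-nonneg 128)
    (≤-trans (x≤x+y (<⇒≤ 0<α)) (x≤x+y 0≤α/δ)))

  128α≤C : lit 128 * α ≤ C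
  128α≤C = *-monoʳ-≤ (lit-nonneg 128) (≤-trans (x≤y+x 0≤1) (x≤x+y 0≤α/δ))

  128α≤Cδ : lit 128 * α ≤ C * δ
  128α≤Cδ = begin
    lit 128 * α                  ≈⟨ *-congˡ (*-identityʳ α) ⟨
    lit 128 * (α * 1#)           ≈⟨ *-congˡ (*-congˡ (⁻¹-inverseˡ 0<δ)) ⟨
    lit 128 * (α * (δ ⁻¹ * δ))   ≈⟨ solve 4 (λ t a i d → t :* (a :* (i :* d)) := t :* (a :* i) :* d) refl _ α (δ ⁻¹) δ ⟩
    lit 128 * (α * δ ⁻¹) * δ     ≤⟨ *-monoˡ-≤ (<⇒≤ 0<δ) (*-monoʳ-≤ (lit-nonneg 128) (x≤y+x 0≤1+α)) ⟩
    C * δ                        ∎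
    where open ≤-Reasoning

  1≤128 : 1# ≤ lit 128
  1≤128 = ≤-respˡ (+-identityˡ 1#) (+-monoˡ-≤ 1# (lit-nonneg 127))

  1≤C : 1# ≤ C
  1≤C = ≤-trans 1≤128 128≤C

  0<C : 0# < C
  0<C = <-≤-trans 0<1 1≤C

  module Large (β : ℝ) (δ<β : δ < β) where

    0<β-δ : 0# < β - δ
    0<β-δ = x≤y⇒0≤y-x (<⇒≤ δ<β) , λ eq → <⇒≉ δ<β (begin
      δ             ≈⟨ +-identityˡ δ ⟨
      0# + δ        ≈⟨ +-congʳ eq ⟩
      (β - δ) + δ   ≈⟨ solve 2 (λ β δ → (β :- δ) :+ δ := β) refl β δ ⟩
      β             ∎)
      where open ≈-Reasoning

    -- For ln n above this value both ln n ≥ 1 and n^(β - δ) ≥ (β - δ) ln n ≥ 8 C hold. Thus β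
    -- influences only how large n has to be, never C.
    threshold : ℝ
    threshold = 1# + lit 8 * C * (β - δ) ⁻¹

    0≤8C/[β-δ] : 0# ≤ lit 8 * C * (β - δ) ⁻¹
    0≤8C/[β-δ] = *-nonneg (*-nonneg (lit-nonneg 8) (<⇒≤ 0<C)) (⁻¹-nonneg 0<β-δ)

    n₀ : ℕ
    n₀ = proj₁ (archimedean (exp threshold))

    module _ (n : ℕ) (n₀≤n : n₀ ℕ.≤ n) where

      l : ℝ
      l = ln (fromℕ n)

      exp-threshold≤n : exp threshold ≤ fromℕ n
      exp-threshold≤n = ≤-trans (proj₂ (archimedean (exp threshold))) (fromℕ-mono n₀≤n)

      exp-l : exp l ≈ fromℕ n
      exp-l = exp-ln (≤-trans (≤-trans (x≤x+y (+-nonneg 0≤1 0≤8C/[β-δ])) (1+x≤exp threshold)) exp-threshold≤n)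

      threshold≤l : threshold ≤ l
      threshold≤l = exp-reflects-≤ (≤-trans exp-threshold≤n (≤-reflexive (sym exp-l)))

      1≤l : 1# ≤ l
      1≤l = ≤-trans (x≤x+y 0≤8C/[β-δ]) threshold≤l

      8C≤exp : lit 8 * C ≤ exp ((β - δ) * l)
      8C≤exp = begin
        lit 8 * C                            ≈⟨ trans (*-congˡ (⁻¹-inverseˡ 0<β-δ)) (*-identityʳ _) ⟨
        lit 8 * C * ((β - δ) ⁻¹ * (β - δ))   ≈⟨ solve 3 (λ c i d → c :* (i :* d) := d :* (c :* i)) refl _ _ (β - δ) ⟩
        (β - δ) * (lit 8 * C * (β - δ) ⁻¹)   ≤⟨ *-monoʳ-≤ (<⇒≤ 0<β-δ) (≤-trans (x≤y+x 0≤1) threshold≤l) ⟩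
        (β - δ) * l                          ≤⟨ x≤y+x 0≤1 ⟩
        1# + (β - δ) * l                     ≤⟨ 1+x≤exp _ ⟩
        exp ((β - δ) * l)                    ∎
        where open ≤-Reasoning

      module _ (a b : ℕ) (l²≤a : l ^ 2 ≤ fromℕ a)
          (h p : ℝ) (1≤h : 1# ≤ h) (h≤n^δ : h ≤ exp (δ * l)) (0<p : 0# < p) (p≤1 : p ≤ 1#)
          (aph≤αl : fromℕ a * p * h ≤ α * l) (n^β<bp : exp (β * l) < fromℕ b * p) where

        open ≤-Reasoning

        A B ρ η Λ D : ℝ
        A = fromℕ a
        B = fromℕ b
        ρ = p * h
        η = proj₁ (exp-surjective 1≤h)
        Λ = ln (e * h)
        D = δ * l

        exp-η : exp η ≈ h
        exp-η = proj₂ (exp-surjective 1≤h)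

        0<l : 0# < l
        0<l = <-≤-trans 0<1 1≤l

        0<h : 0# < h
        0<h = <-≤-trans 0<1 1≤h

        0<ρ : 0# < ρ
        0<ρ = *-pos 0<p 0<h

        Aρ≤αl : A * ρ ≤ α * l
        Aρ≤αl = ≤-respˡ (*-assoc A p h) aph≤αl

        -- From ln² n ≤ a follows ln² n · ρ ≤ a ρ ≤ α ln n. So ρ is at most α / ln n, which keeps
        -- the number of levels and the smallness of σ under control.
        lρ≤α : l * ρ ≤ α
        lρ≤α = *-cancelʳ-≤ 0<l (begin
          l * ρ * l     ≈⟨ solve 2 (λ l r → l :* r :* l := l :* (l :* :1) :* r) refl l ρ ⟩
          l ^ 2 * ρ     ≤⟨ *-monoˡ-≤ (<⇒≤ 0<ρ) l²≤a ⟩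
          A * ρ         ≤⟨ Aρ≤αl ⟩
          α * l         ∎)

        0≤η : 0# ≤ η
        0≤η = exp-reflects-≤ (begin
          exp 0#   ≈⟨ exp-0 ⟩
          1#       ≤⟨ 1≤h ⟩
          h        ≈⟨ exp-η ⟨
          exp η    ∎)

        1≤e*h : 1# ≤ e * h
        1≤e*h = ≤-respˡ (*-identityˡ 1#)
          (*-mono-≤ 0≤1 0≤1 (≤-trans (x≤x+y 0≤1) (1+x≤exp 1#)) 1≤h)

        exp-Λ : exp Λ ≈ exp (1# + η)
        exp-Λ = begin-equality
          exp Λ              ≈⟨ exp-ln 1≤e*h ⟩
          exp 1# * h         ≈⟨ *-congˡ exp-η ⟨
          exp 1# * exp η     ≈⟨ exp-+ 1# η ⟨
          exp (1# + η)       ∎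

        Λ≈1+η : Λ ≈ 1# + η
        Λ≈1+η = antisym (exp-reflects-≤ (≤-reflexive exp-Λ)) (exp-reflects-≤ (≤-reflexive (sym exp-Λ)))

        1≤Λ : 1# ≤ Λ
        1≤Λ = ≤-respʳ (sym Λ≈1+η) (x≤x+y 0≤η)

        0<Λ : 0# < Λ
        0<Λ = <-≤-trans 0<1 1≤Λ

        η≤Λ : η ≤ Λ
        η≤Λ = ≤-respʳ (sym Λ≈1+η) (x≤y+x 0≤1)

        Λ≤h : Λ ≤ h
        Λ≤h = ≤-respˡ (sym Λ≈1+η) (≤-respʳ exp-η (1+x≤exp η))

        1≤CΛ : 1# ≤ C * Λ
        1≤CΛ = ≤-respˡ (*-identityˡ 1#) (*-mono-≤ 0≤1 0≤1 1≤C 1≤Λ)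

        J-floor = floor (C * (Λ * ρ ⁻¹)) (*-nonneg (<⇒≤ 0<C) (*-nonneg (<⇒≤ 0<Λ) (⁻¹-nonneg 0<ρ)))

        J : ℕ
        J = proj₁ J-floor

        j : ℝ
        j = fromℕ J

        cancel-ρ : C * (Λ * ρ ⁻¹) * ρ ≈ C * Λ
        cancel-ρ = begin-equality
          C * (Λ * ρ ⁻¹) * ρ     ≈⟨ solve 4 (λ c L i r → c :* (L :* i) :* r := c :* L :* (i :* r)) refl C Λ (ρ ⁻¹) ρ ⟩
          C * Λ * (ρ ⁻¹ * ρ)     ≈⟨ trans (*-congˡ (⁻¹-inverseˡ 0<ρ)) (*-identityʳ _) ⟩
          C * Λ                  ∎

        jρ≤CΛ : j * ρ ≤ C * Λ
        jρ≤CΛ = ≤-respʳ cancel-ρ (*-monoˡ-≤ (<⇒≤ 0<ρ) (proj₁ (proj₂ J-floor)))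

        CΛ≤[1+j]ρ : C * Λ ≤ (1# + j) * ρ
        CΛ≤[1+j]ρ = ≤-respˡ cancel-ρ (*-monoˡ-≤ (<⇒≤ 0<ρ) (proj₂ (proj₂ J-floor)))

        -- C Λ / ρ is at least 2, so passing to its integer part J loses at most a factor 2, and J
        -- is not 0.
        2ρ≤CΛ : lit 2 * ρ ≤ C * Λ
        2ρ≤CΛ = begin
          lit 2 * ρ          ≤⟨ *-monoʳ-≤ (lit-nonneg 2) (≤-respˡ (*-identityˡ ρ) (*-monoˡ-≤ (<⇒≤ 0<ρ) 1≤l)) ⟩
          lit 2 * (l * ρ)    ≤⟨ *-monoʳ-≤ (lit-nonneg 2) lρ≤α ⟩
          lit 2 * α          ≤⟨ shift-≤ (*-nonneg (lit-nonneg 126) (<⇒≤ 0<α))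
                                  (solve 1 (λ a → :lit 128 :* a :+ :0 := :lit 2 :* a :+ :lit 126 :* a) refl α) ⟩
          lit 128 * α        ≤⟨ 128α≤C ⟩
          C                  ≈⟨ *-identityʳ C ⟨
          C * 1#             ≤⟨ *-monoʳ-≤ (<⇒≤ 0<C) 1≤Λ ⟩
          C * Λ              ∎

        CΛ≤2jρ : C * Λ ≤ lit 2 * (j * ρ)
        CΛ≤2jρ = shift-≤ (+-mono-≤ (+-mono-≤ CΛ≤[1+j]ρ CΛ≤[1+j]ρ) 2ρ≤CΛ)
          (solve 3 (λ c j r → :lit 2 :* (j :* r) :+ ((c :+ c) :+ :lit 2 :* r)
            := c :+ (((:1 :+ j) :* r :+ (:1 :+ j) :* r) :+ c)) refl (C * Λ) j ρ)

        0<j : 0# < j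
        0<j = fromℕ-nonneg J , λ eq → 0≉1 (antisym 0≤1 (begin
          1#                   ≤⟨ 1≤CΛ ⟩
          C * Λ                ≤⟨ CΛ≤2jρ ⟩
          lit 2 * (j * ρ)      ≈⟨ *-congˡ (*-congʳ eq) ⟨
          lit 2 * (0# * ρ)     ≈⟨ solve 1 (λ r → :lit 2 :* (:0 :* r) := :0) refl ρ ⟩
          0#                   ∎))

        σ : ℝ
        σ = A * (j * j) ⁻¹

        σj²≈A : σ * (j * j) ≈ A
        σj²≈A = trans (*-assoc A _ _) (trans (*-congˡ (⁻¹-inverseˡ (*-pos 0<j 0<j))) (*-identityʳ A))

        0≤σ : 0# ≤ σ
        0≤σ = *-nonneg (fromℕ-nonneg a) (⁻¹-nonneg (*-pos 0<j 0<j))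

        C≤CΛ : C ≤ C * Λ
        C≤CΛ = ≤-respˡ (*-identityʳ C) (*-monoʳ-≤ (<⇒≤ 0<C) 1≤Λ)

        -- From J ≥ C Λ / (2 ρ) ≥ C / (2 ρ): σ = a / J² is at most 4 a ρ² / C², and a ρ ≤ α ln n.
        σC²≤4αlρ : σ * (C * C) ≤ lit 4 * (α * l * ρ)
        σC²≤4αlρ = begin
          σ * (C * C)                                      ≤⟨ *-monoʳ-≤ 0≤σ (*-mono-≤ (<⇒≤ 0<C) (<⇒≤ 0<C)
                                                                (≤-trans C≤CΛ CΛ≤2jρ) (≤-trans C≤CΛ CΛ≤2jρ)) ⟩
          σ * (lit 2 * (j * ρ) * (lit 2 * (j * ρ)))        ≈⟨ solve 3 (λ s j r → s :* (:lit 2 :* (j :* r) :* (:lit 2 :* (j :* r)))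
                                                                := :lit 4 :* (s :* (j :* j) :* r :* r)) refl σ j ρ ⟩
          lit 4 * (σ * (j * j) * ρ * ρ)                    ≈⟨ *-congˡ (*-congʳ (*-congʳ σj²≈A)) ⟩
          lit 4 * (A * ρ * ρ)                              ≤⟨ *-monoʳ-≤ (lit-nonneg 4) (*-monoˡ-≤ (<⇒≤ 0<ρ) Aρ≤αl) ⟩
          lit 4 * (α * l * ρ)                              ∎

        32σ≤1 : lit 32 * σ ≤ 1#
        32σ≤1 = *-cancelʳ-≤ (*-pos 0<C 0<C) (begin
          lit 32 * σ * (C * C)              ≈⟨ *-assoc _ _ _ ⟩
          lit 32 * (σ * (C * C))            ≤⟨ *-monoʳ-≤ (lit-nonneg 32) σC²≤4αlρ ⟩
          lit 32 * (lit 4 * (α * l * ρ))    ≈⟨ *-congˡ (*-congˡ (*-assoc α l ρ)) ⟩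
          lit 32 * (lit 4 * (α * (l * ρ)))  ≤⟨ *-monoʳ-≤ (lit-nonneg 32) (*-monoʳ-≤ (lit-nonneg 4) (*-monoʳ-≤ (<⇒≤ 0<α) lρ≤α)) ⟩
          lit 32 * (lit 4 * (α * α))        ≈⟨ solve 1 (λ a → :lit 32 :* (:lit 4 :* (a :* a)) := (:lit 128 :* a) :* a) refl α ⟩
          (lit 128 * α) * α                 ≤⟨ *-mono-≤ (*-nonneg (lit-nonneg 128) (<⇒≤ 0<α)) (<⇒≤ 0<α) 128α≤C α≤C ⟩
          C * C                             ≈⟨ *-identityˡ _ ⟨
          1# * (C * C)                      ∎)
          where
          α≤C : α ≤ C
          α≤C = ≤-trans (≤-respˡ (*-identityˡ α) (*-monoˡ-≤ (<⇒≤ 0<α) 1≤128)) 128α≤C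

        256σ≤Dρ : lit 256 * σ ≤ D * ρ
        256σ≤Dρ = *-cancelʳ-≤ (*-pos 0<C 0<C) (begin
          lit 256 * σ * (C * C)                      ≈⟨ *-assoc _ _ _ ⟩
          lit 256 * (σ * (C * C))                    ≤⟨ *-monoʳ-≤ (lit-nonneg 256) σC²≤4αlρ ⟩
          lit 256 * (lit 4 * (α * l * ρ))            ≈⟨ solve 3 (λ a l r → :lit 256 :* (:lit 4 :* (a :* l :* r))
                                                          := (:lit 128 :* a) :* :lit 8 :* (l :* r)) refl α l ρ ⟩
          (lit 128 * α) * lit 8 * (l * ρ)            ≤⟨ *-monoˡ-≤ (*-nonneg (<⇒≤ 0<l) (<⇒≤ 0<ρ))
                                                          (*-mono-≤ (*-nonneg (lit-nonneg 128) (<⇒≤ 0<α)) (lit-nonneg 8) 128α≤Cδ 8≤C) ⟩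
          C * δ * C * (l * ρ)                        ≈⟨ solve 4 (λ c d l r → c :* d :* c :* (l :* r) := d :* l :* r :* (c :* c)) refl C δ l ρ ⟩
          D * ρ * (C * C)                            ∎)
          where
          8≤C : lit 8 ≤ C
          8≤C = ≤-trans (shift-≤ (lit-nonneg 120) (solve 0 (:lit 128 :+ :0 := :lit 8 :+ :lit 120) refl)) 128≤C

        -- This is where J needs its factor ln (e h): σ J = a / J and J ≥ C Λ / (2 ρ), so the η here
        -- cancels against Λ ≥ η and only a ρ ≤ α ln n is left.
        8σjη≤D : lit 8 * (σ * j * η) ≤ D
        8σjη≤D = *-cancelʳ-≤ 0<C (begin
          lit 8 * (σ * j * η) * C                    ≈⟨ solve 4 (λ s j e c → :lit 8 :* (s :* j :* e) :* c := :lit 8 :* (s :* j :* (c :* e))) refl σ j η C ⟩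
          lit 8 * (σ * j * (C * η))                  ≤⟨ *-monoʳ-≤ (lit-nonneg 8) (*-monoʳ-≤ (*-nonneg 0≤σ (<⇒≤ 0<j))
                                                          (≤-trans (*-monoʳ-≤ (<⇒≤ 0<C) η≤Λ) CΛ≤2jρ)) ⟩
          lit 8 * (σ * j * (lit 2 * (j * ρ)))        ≈⟨ solve 3 (λ s j r → :lit 8 :* (s :* j :* (:lit 2 :* (j :* r)))
                                                          := :lit 16 :* (s :* (j :* j) :* r)) refl σ j ρ ⟩
          lit 16 * (σ * (j * j) * ρ)                 ≈⟨ *-congˡ (*-congʳ σj²≈A) ⟩
          lit 16 * (A * ρ)                           ≤⟨ *-monoʳ-≤ (lit-nonneg 16) Aρ≤αl ⟩
          lit 16 * (α * l)                           ≤⟨ shift-≤ (*-nonneg (lit-nonneg 112) (*-nonneg (<⇒≤ 0<α) (<⇒≤ 0<l)))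
                                                          (solve 2 (λ a l → :lit 128 :* a :* l :+ :0
                                                            := :lit 16 :* (a :* l) :+ :lit 112 :* (a :* l)) refl α l) ⟩
          lit 128 * α * l                            ≤⟨ *-monoˡ-≤ (<⇒≤ 0<l) 128α≤Cδ ⟩
          C * δ * l                                  ≈⟨ solve 3 (λ c d l → c :* d :* l := d :* l :* c) refl C δ l ⟩
          D * C                                      ∎)

        open RandomGraph em R p (<⇒≤ 0<p) p≤1
        open Greedy em R p (<⇒≤ 0<p) p≤1
        open Levels h η D σ 0<p 1≤h exp-η h≤n^δ 0≤σ 0≤η J 32σ≤1 256σ≤Dρ 8σjη≤D
          using (M; q; τ; 0≤q; success)

        r N⁻ : ℝ
        r = 1# - ½ * q
        N⁻ = exp (- δ * l)

        q+2r≈2 : q + (r + r) ≈ 1# + 1#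
        q+2r≈2 = trans (+-congʳ (sym (½+½ q)))
          (solve 1 (λ x → (x :+ x) :+ ((:1 :- x) :+ (:1 :- x)) := :1 :+ :1) refl (½ * q))

        N⁻≈exp-D : exp (- D) ≈ N⁻
        N⁻≈exp-D = exp-cong (solve 2 (λ d l → :- (d :* l) := :- d :* l) refl δ l)

        2q≈N⁻ : q + q ≈ N⁻
        2q≈N⁻ = trans (½+½ _) N⁻≈exp-D

        0≤r : 0# ≤ r
        0≤r = x≤y⇒0≤y-x (begin
          ½ * q        ≤⟨ <⇒≤-½ ⟩
          q + q        ≈⟨ ½+½ _ ⟩
          exp (- D)    ≤⟨ exp-mono-≤ (≤-respʳ -0≈0 (neg-anti-≤ (<⇒≤ (*-pos 0<δ 0<l)))) ⟩
          exp 0#       ≈⟨ exp-0 ⟩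
          1#           ∎)
          where
          -0≈0 : - 0# ≈ 0#
          -0≈0 = solve 0 (:- :0 := :0) refl
          <⇒≤-½ : ½ * q ≤ q + q
          <⇒≤-½ = ≤-trans (≤-respʳ (½+½ q) (x≤x+y (*-nonneg (<⇒≤ 0<½) 0≤q))) (x≤x+y 0≤q)

        open Scan {a} τ J q r q+2r≈2 0≤r success using (Event; 2^; ℙ-Event)

        8j≤N⁻B : lit 8 * j ≤ N⁻ * B
        8j≤N⁻B = *-cancelʳ-≤ 0<p (begin
          lit 8 * j * p                    ≈⟨ *-assoc _ j p ⟩
          lit 8 * (j * p)                  ≤⟨ *-monoʳ-≤ (lit-nonneg 8) jp≤C ⟩
          lit 8 * C                        ≤⟨ 8C≤exp ⟩
          exp ((β - δ) * l)                ≈⟨ exp-cong (solve 3 (λ b d l → (b :- d) :* l := :- d :* l :+ b :* l) refl β δ l) ⟩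
          exp (- δ * l + β * l)            ≈⟨ exp-+ _ _ ⟩
          N⁻ * exp (β * l)                 ≤⟨ *-monoʳ-≤ (<⇒≤ (exp-pos _)) (<⇒≤ n^β<bp) ⟩
          N⁻ * (B * p)                     ≈⟨ *-assoc N⁻ B p ⟨
          N⁻ * B * p                       ∎)
          where
          jp≤C : j * p ≤ C
          jp≤C = *-cancelʳ-≤ 0<h (begin
            j * p * h     ≈⟨ *-assoc j p h ⟩
            j * ρ         ≤⟨ jρ≤CΛ ⟩
            C * Λ         ≤⟨ *-monoʳ-≤ (<⇒≤ 0<C) Λ≤h ⟩
            C * h         ∎)

        8C⁻¹≤1 : lit 8 * C ⁻¹ ≤ 1#
        8C⁻¹≤1 = x*y⁻¹≤z 0<C (≤-respʳ (sym (*-identityˡ C)) (≤-trans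
          (shift-≤ (lit-nonneg 120) (solve 0 (:lit 128 :+ :0 := :lit 8 :+ :lit 120) refl)) 128≤C))

        failure : 2^ J * r ^ b ≤ exp (- ((N⁻ * B) / C))
        failure = begin
          2^ J * r ^ b                            ≤⟨ *-mono-≤ (^-nonneg J (+-nonneg 0≤1 0≤1)) (^-nonneg b 0≤r)
                                                       (^-mono-≤ J (+-nonneg 0≤1 0≤1) (1+x≤exp 1#))
                                                       (^-mono-≤ b 0≤r (1+x≤exp (- (½ * q)))) ⟩
          exp 1# ^ J * exp (- (½ * q)) ^ b        ≈⟨ *-cong (exp-^ 1# J) (exp-^ _ b) ⟩
          exp (j * 1#) * exp (B * - (½ * q))      ≈⟨ exp-+ _ _ ⟨
          exp (j * 1# + B * - (½ * q))            ≤⟨ exp-mono-≤ exponent ⟩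
          exp (- ((N⁻ * B) / C))                  ∎
          where
          N⁻≈4u : N⁻ ≈ (½ * q + ½ * q) + (½ * q + ½ * q)
          N⁻≈4u = sym (trans (+-cong (½+½ q) (½+½ q)) 2q≈N⁻)
          exponent : j * 1# + B * - (½ * q) ≤ - ((N⁻ * B) / C)
          -- Since q/2 is a quarter of N⁻, eight times the exponent is 8 J - 2 N⁻ B ≤ - N⁻ B; then C
          -- ≥ 8 weakens the rate 1/8 to 1/C.
          exponent = *-cancelˡ-≤ {lit 8} (<-≤-trans 0<1 (≤-respˡ (+-identityˡ 1#) (+-monoˡ-≤ 1# (lit-nonneg 7)))) (begin
            lit 8 * (j * 1# + B * - (½ * q))          ≈⟨ solve 3 (λ j B u → :lit 8 :* (j :* :1 :+ B :* :- u)
                                                           := :lit 8 :* j :- (((u :+ u) :+ (u :+ u)) :* B :+ ((u :+ u) :+ (u :+ u)) :* B)) refl j B (½ * q) ⟩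
            lit 8 * j - (n₄ * B + n₄ * B)             ≈⟨ +-congˡ (-‿cong (+-cong (*-congʳ N⁻≈4u) (*-congʳ N⁻≈4u))) ⟨
            lit 8 * j - (N⁻ * B + N⁻ * B)             ≤⟨ shift-≤ 8j≤N⁻B (solve 2 (λ x y → :- y :+ x := (x :- (y :+ y)) :+ y) refl _ _) ⟩
            - (N⁻ * B)                                ≤⟨ neg-anti-≤ (≤-respˡ (solve 3 (λ t c x → x :* (t :* c) := t :* (x :* c)) refl (lit 8) (C ⁻¹) (N⁻ * B))
                                                           (≤-respʳ (*-identityʳ _) (*-monoʳ-≤ (*-nonneg (<⇒≤ (exp-pos _)) (fromℕ-nonneg b)) 8C⁻¹≤1))) ⟩
            - (lit 8 * (N⁻ * B * C ⁻¹))               ≈⟨ solve 2 (λ t x → :- (t :* x) := t :* (:- x)) refl (lit 8) _ ⟩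
            lit 8 * - (N⁻ * B * C ⁻¹)                 ∎)
            where n₄ = (½ * q + ½ * q) + (½ * q + ½ * q)

        initial : fromℕ ∣ ⊤ {a} ∣ ≤ τ J
        initial = begin
          fromℕ ∣ ⊤ {a} ∣      ≡⟨ ≡.cong fromℕ (∣⊤∣≡n a) ⟩
          A                    ≈⟨ σj²≈A ⟨
          σ * (j * j)          ≤⟨ x≤y+x (*-nonneg 0≤1 (⁻¹-nonneg 0<ρ)) ⟩
          τ J                  ∎

        conclusion : 1# - exp (- ((N⁻ * B) / C)) ≤ ℙ a b p (λ G →
          ∃₂ λ (A′ : Subset a) (D : Subset b) →
            fromℕ ∣ A′ ∣ ≤ 1# / (p * h) × Dominates G D (∁ A′) ×
            fromℕ ∣ D ∣ ≤ C * (Λ / (p * h)))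
        conclusion = begin
          1# - exp (- ((N⁻ * B) / C))   ≤⟨ +-monoʳ-≤ 1# (neg-anti-≤ failure) ⟩
          1# - 2^ J * r ^ b             ≤⟨ ℙ-Event b J ⊤ ℕ.≤-refl initial ⟩
          ℙ a b p (Event J ⊤)           ≤⟨ ℙ-mono a b (λ { G (A′ , D , small , dom , ∣D∣≤J) →
            A′ , D ,
            -- Level 0 has no quadratic part, so the leftover set satisfies exactly the bound 1 / (p
            -- h).
            ≤-respʳ (solve 2 (λ M s → M :+ s :* (:0 :* :0) := M) refl M σ) small ,
            (λ u u∈ → dom u ∈⊤ (x∈∁p⇒x∉p u∈)) ,
            ≤-trans (fromℕ-mono ∣D∣≤J) (proj₁ (proj₂ J-floor)) }) ⟩
          ℙ a b p _                     ∎

theorem4p2 : (em : ExcludedMiddle 0ℓ) (R : CompleteOrderedField) →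
    let open Reals em R in
    (α δ : ℝ) → 0# < α → 0# < δ →
    ∃ λ (C : ℝ) → 1# ≤ C ×
    ((β : ℝ) → 0# < β → δ < β →
    ∃ λ (n₀ : ℕ) → (n : ℕ) → n₀ ℕ.≤ n →
    (a b : ℕ) → ln (fromℕ n) ^ 2 ≤ fromℕ a → a ℕ.≤ b → b ℕ.≤ n →
    (h p : ℝ) → 1# ≤ h → h ≤ fromℕ n ^ʳ δ → 0# < p → p ≤ 1# →
    fromℕ a * p * h ≤ α * ln (fromℕ n) →
    fromℕ n ^ʳ β < fromℕ b * p →
    1# - exp (- ((fromℕ n ^ʳ (- δ) * fromℕ b) / C))
    ≤ ℙ a b p (λ G →
    ∃₂ λ (A′ : Subset a) (D : Subset b) →
    fromℕ ∣ A′ ∣ ≤ 1# / (p * h) ×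
    Dominates G D (∁ A′) ×
    fromℕ ∣ D ∣ ≤ C * (ln (e * h) / (p * h))))
theorem4p2 em R α δ 0<α 0<δ = C , 1≤C , λ β 0<β δ<β → Large.n₀ β δ<β ,
  λ n n₀≤n a b l²≤a a≤b b≤n h p 1≤h h≤n^δ 0<p p≤1 aph≤αl n^β<bp →
  Large.conclusion β δ<β n n₀≤n a b l²≤a h p 1≤h h≤n^δ 0<p p≤1 aph≤αl n^β<bp
  where open Bound em R α δ 0<α 0<δ
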